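{- (Myhill, Shepherdson) Let $A\subseteq\omega$ be an infinite c.e. set, $m,n\ge1$, and for every $i\ge1$ let $\theta^{(i)}$ be a quasi-Gödel numbering of $\mathcal S^{(i)}_A$ (with respect to which Markov-computability is understood). (1) The restriction to $\mathcal S^{(n)}_A$ of every computable operator $\widehat G:\widehat{\mathcal S}^{(n)}_A\to\widehat{\mathcal S}^{(m)}_A$ is Markov-computable. (2) Every Markov-computable operator $G:\mathcal S^{(n)}_A\to\mathcal S^{(m)}_A$ is the restriction to $\mathcal S^{(n)}_A$ of a computable operator $\widehat G:\widehat{\mathcal S}^{(n)}_A\to\widehat{\mathcal S}^{(m)}_A$.
   Context: $\omega$ is the set of natural numbers; $\mathcal F^{(n)}$ and $\mathcal R^{(n)}$ are the sets of all total, respectively all total computable, functions $\omega^n\to\omega$. $\langle\cdot,\cdot\rangle:\omega^2\to\omega$ is a computable bijection with $\langle x,y\rangle\ge x,y$, extended by $\langle x\rangle=x$, $\langle x_1,\dots,x_{n+1}\rangle=\langle x_1,\langle x_2,\dots,x_{n+1}\rangle\rangle$. $\mathrm{Anf}^{(n)}_A$ is the set of partial functions from $\omega^n$ to $\omega$ whose domain is either empty or equal to $\{0,\dots,a-1\}^n$ for some $a\in A$; $\mathcal S^{(n)}_A=\mathcal R^{(n)}\cup\mathrm{Anf}^{(n)}_A$ and $\widehat{\mathcal S}^{(n)}_A=\mathcal F^{(n)}\cup\mathrm{Anf}^{(n)}_A$. For an $n$-ary partial function $q$, $\mathrm{graph}(q)=\{\langle\langle\vec x\rangle,q(\vec x)\rangle:\vec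 x\in\mathrm{dom}(q)\}$, and the extended graph of $q$ is $\{\langle\langle\vec y\rangle,0\rangle:\vec y\in\omega^n\}\cup\{\langle\langle\vec x\rangle,q(\vec x)+1\rangle:\vec x\in\mathrm{dom}(q)\}$. A numbering of a set $X$ is a surjection $\omega\to X$. A numbering $\theta$ of $\mathcal S^{(n)}_A$ is a quasi-Gödel numbering if: (QGN I) the extended graph of $(i,\vec x)\mapsto\theta_i(\vec x)$ is the range of a function in $\mathcal R^{(1)}$; and (QGN II) for every $k\in\mathcal R^{(2)}$ there is $v\in\mathcal R^{(1)}$ such that for all $i\in\omega$, $r\in\mathcal S^{(n)}_A$: if $\{k(i,t):t\in\omega\}$ is the extended graph of $r$, then $r=\theta_{v(i)}$. Fix an effective bijective coding of finite sequences of natural numbers by natural numbers. An operator $\widehat G:\widehat{\mathcal S}^{(n)}_A\to\widehat{\mathcal S}^{(m)}_A$ is computable if there is a c.e. set $C\subseteq\omega$ such that for all $r\in\widehat{\mathcal S}^{(n)}_A$, $\mathrm{graph}(\widehat G(r))$ is the set of all $\langle\langle\vec y\rangle,z\rangle$ for which there is $a\in\omega$ with $\langle\langle\langle\vec y\rangle,z\rangle,a\rangle\in C$ such that every entry of the finite sequence coded by $a$ belongs to $\mathrm{graph}(r)$. An operator $G:\mathcal S^{(n)}_A\to\mathcal S^{(m)}_A$ is Markov-computable if there is $g\in\mathcal R^{(1)}$ with $G(\theta^{(n)}_i)=\theta^{(m)}_{g(i)}$ for all $i\in\omega$. -}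

module Defs where

open import Level using (0ℓ)
open import Data.List.Base as List using (List; length; drop)
open import Data.List.Membership.Propositional using () renaming (_∈_ to _∈ᴸ_)
import Data.List.Relation.Unary.All as Listᴬ
open import Data.Maybe.Base using (Maybe; just; fromMaybe)
open import Data.Nat.Base using (ℕ; zero; suc; _≤_; _<_; NonZero)
open import Data.Fin.Base using (Fin)
open import Data.Product.Base using (Σ; ∃; ∃₂; _×_; _,_; proj₁; proj₂; uncurry)
open import Data.Sum.Base using (_⊎_; inj₁; inj₂)
open import Data.Vec.Base as Vec using (Vec; []; _∷_; head; tail; lookup)
open import Data.Vec.N-ary using (N-ary; _$ⁿ_)
open import Data.Vec.Relation.Binary.Pointwise.Inductive using (Pointwise)
open import Data.Vec.Relation.Unary.All using (All)
open import Function.Base using (_∘_)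
open import Function.Bundles using (Func; Surjection; _⟶ₛ_)
open import Function.Definitions using (Bijective)
open import Relation.Binary.Bundles using (Setoid)
open import Relation.Binary.PropositionalEquality as ≡ using (_≡_; _≗_)
open import Relation.Nullary.Negation.Core using (¬_)
open import Relation.Unary using (Pred; _∈_; _⊆_; _≐_; _∪_; Empty)

data μRec : ℕ → Set where
  zer  : ∀ {n} → μRec n
  succ : μRec 1
  proj : ∀ {n} → Fin n → μRec n
  comp : ∀ {n k} → μRec k → Vec (μRec n) k → μRec n
  prec : ∀ {n} → μRec n → μRec (suc (suc n)) → μRec (suc n)
  mini : ∀ {n} → μRec (suc n) → μRec n

infix 4 _[_]⇓_

-- e [ xs ]⇓ y : the partial function computed by e is defined at xs,
-- with value y.
data _[_]⇓_ : ∀ {n} → μRec n → Vec ℕ n → ℕ → Set where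
  zer⇓  : ∀ {n} {xs : Vec ℕ n} → zer [ xs ]⇓ 0
  succ⇓ : ∀ {x} → succ [ x ∷ [] ]⇓ suc x
  proj⇓ : ∀ {n} {xs : Vec ℕ n} (i : Fin n) → proj i [ xs ]⇓ lookup xs i
  comp⇓ : ∀ {n k} {e : μRec k} {es : Vec (μRec n) k} {xs ys z} →
          Pointwise (λ e′ y → e′ [ xs ]⇓ y) es ys →
          e [ ys ]⇓ z → comp e es [ xs ]⇓ z
  prec⇓zero : ∀ {n} {b : μRec n} {s} {xs y} →
              b [ xs ]⇓ y → prec b s [ zero ∷ xs ]⇓ y
  prec⇓suc  : ∀ {n} {b : μRec n} {s} {k xs y z} →
              prec b s [ k ∷ xs ]⇓ y → s [ k ∷ y ∷ xs ]⇓ z →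
              prec b s [ suc k ∷ xs ]⇓ z
  mini⇓ : ∀ {n} {e : μRec (suc n)} {xs y} →
          e [ y ∷ xs ]⇓ 0 →
          (∀ z → z < y → ∃ λ w → e [ z ∷ xs ]⇓ suc w) →
          mini e [ xs ]⇓ y

Computable : ∀ {n} → (Vec ℕ n → ℕ) → Set
Computable {n} f = Σ (μRec n) λ e → ∀ xs → e [ xs ]⇓ f xs

Computableⁿ : ∀ n → N-ary n ℕ ℕ → Set
Computableⁿ n f = Computable {n} (f $ⁿ_)

Range : (ℕ → ℕ) → Pred ℕ 0ℓ
Range f w = ∃ λ t → w ≡ f t

CE : Pred ℕ 0ℓ → Set
CE B = Empty B ⊎ ∃ λ f → Computableⁿ 1 f × B ≐ Range f

Infinite : Pred ℕ 0ℓ → Set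
Infinite B = ¬ ∃ λ (xs : List ℕ) → B ⊆ (_∈ᴸ xs)

record Pairing : Set where
  field
    ⟨_,_⟩      : ℕ → ℕ → ℕ
    computable : Computableⁿ 2 ⟨_,_⟩
    bijective  : Bijective _≡_ _≡_ (uncurry ⟨_,_⟩)
    ≥-left     : ∀ x y → x ≤ ⟨ x , y ⟩
    ≥-right    : ∀ x y → y ≤ ⟨ x , y ⟩

  tuple : ∀ {n} .{{_ : NonZero n}} → Vec ℕ n → ℕ
  tuple (x ∷ [])     = x
  tuple (x ∷ y ∷ xs) = ⟨ x , tuple (y ∷ xs) ⟩

-- The i-th entry of xs, or 0 if i is not an index of xs.
entry : List ℕ → ℕ → ℕ
entry xs i = fromMaybe 0 (List.head (drop i xs))

-- Effectiveness means that the length and the entries of the sequence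
-- coded by a can be computed from a.  As the coding is bijective, the code
-- of a sequence can then also be computed, by unbounded search.
record SequenceCoding : Set where
  field
    decode             : ℕ → List ℕ
    bijective          : Bijective _≡_ _≡_ decode
    length-computable  : Computableⁿ 1 (λ a → length (decode a))
    entries-computable : Computableⁿ 2 (λ a i → entry (decode a) i)

-- Classically, a partial function ω^n → ω is a total function into ω with
-- an additional value 'nothing' for "undefined".  No computability is
-- intended: a partial function may be arbitrary, and under excluded middle
-- every single-valued relation is of this form.
PFun : ℕ → Set
PFun n = Vec ℕ n → Maybe ℕ

dom : ∀ {n} → PFun n → Pred (Vec ℕ n) 0ℓ
dom q xs = ∃ λ y → q xs ≡ just y

ℱ : ∀ n → Pred (PFun n) 0ℓ
ℱ n q = ∃ λ f → q ≗ just ∘ f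

ℛ : ∀ n → Pred (PFun n) 0ℓ
ℛ n q = ∃ λ f → Computable f × q ≗ just ∘ f

Anf : Pred ℕ 0ℓ → ∀ n → Pred (PFun n) 0ℓ
Anf A n q = Empty (dom q) ⊎ ∃ λ a → a ∈ A × dom q ≐ All (_< a)

subsetoid : ∀ {n} → Pred (PFun n) 0ℓ → Setoid 0ℓ 0ℓ
subsetoid P = record
  { Carrier       = ∃ P
  ; _≈_           = λ r s → proj₁ r ≗ proj₁ s
  ; isEquivalence = record
    { refl  = λ _ → ≡.refl
    ; sym   = λ r≈s xs → ≡.sym (r≈s xs)
    ; trans = λ r≈s s≈t xs → ≡.trans (r≈s xs) (s≈t xs)
    }
  }

𝒮 Ŝ : Pred ℕ 0ℓ → ℕ → Setoid 0ℓ 0ℓ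
𝒮 A n = subsetoid (ℛ n ∪ Anf A n)
Ŝ A n = subsetoid (ℱ n ∪ Anf A n)

inclusion : ∀ {A n} → Setoid.Carrier (𝒮 A n) → Setoid.Carrier (Ŝ A n)
inclusion (q , inj₁ (f , _ , q≗f)) = q , inj₁ (f , q≗f)
inclusion (q , inj₂ q∈Anf)         = q , inj₂ q∈Anf

module _ (P : Pairing) where
  open Pairing P

  graph : ∀ {n} .{{_ : NonZero n}} → PFun n → Pred ℕ 0ℓ
  graph q w = ∃₂ λ xs z → q xs ≡ just z × w ≡ ⟨ tuple xs , z ⟩

  extendedGraph : ∀ {n} .{{_ : NonZero n}} → PFun n → Pred ℕ 0ℓ
  extendedGraph {n} q =
    (λ w → ∃ λ (ys : Vec ℕ n) → w ≡ ⟨ tuple ys , 0 ⟩) ∪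
    (λ w → ∃₂ λ xs z → q xs ≡ just z × w ≡ ⟨ tuple xs , suc z ⟩)

Numbering : Setoid 0ℓ 0ℓ → Set
Numbering X = Surjection (≡.setoid ℕ) X

module _ {A : Pred ℕ 0ℓ} {n : ℕ} where

  -- (i , xs) ↦ θ i xs
  universal : Numbering (𝒮 A n) → PFun (suc n)
  universal θ ixs = proj₁ (Surjection.to θ (head ixs)) (tail ixs)

  record IsQuasiGödel (P : Pairing) .{{_ : NonZero n}}
                      (θ : Numbering (𝒮 A n)) : Set where
    open Surjection θ using () renaming (to to θ[_])
    open Setoid (𝒮 A n) using (Carrier; _≈_)
    field
      QGN-I  : ∃ λ h → Computableⁿ 1 h ×
                 extendedGraph P (universal θ) ≐ Range h
      QGN-II : ∀ (k : ℕ → ℕ → ℕ) → Computableⁿ 2 k →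
               ∃ λ v → Computableⁿ 1 v ×
                 (∀ i (r : Carrier) →
                    Range (k i) ≐ extendedGraph P (proj₁ r) →
                    r ≈ θ[ v i ])

module _ {A : Pred ℕ 0ℓ} {n m : ℕ} where

  ComputableOperator : Pairing → SequenceCoding →
                       .{{_ : NonZero n}} .{{_ : NonZero m}} →
                       Ŝ A n ⟶ₛ Ŝ A m → Set₁
  ComputableOperator P S Ĝ = ∃ λ (C : Pred ℕ 0ℓ) → CE C ×
    (∀ r → graph P (proj₁ (Func.to Ĝ r)) ≐
       λ w → ∃₂ λ (ys : Vec ℕ m) z → w ≡ ⟨ tuple ys , z ⟩ ×
         ∃ λ a → ⟨ ⟨ tuple ys , z ⟩ , a ⟩ ∈ C ×
                 Listᴬ.All (graph P (proj₁ r)) (decode a))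
    where
    open Pairing P using (⟨_,_⟩; tuple)
    open SequenceCoding S using (decode)

  MarkovComputable : Numbering (𝒮 A n) → Numbering (𝒮 A m) →
                     𝒮 A n ⟶ₛ 𝒮 A m → Set
  MarkovComputable θ θ′ G = ∃ λ g → Computableⁿ 1 g ×
    (∀ i → Func.to G (Surjection.to θ i) ≈ Surjection.to θ′ (g i))
    where open Setoid (𝒮 A m) using (_≈_)

  -- In particular, Ĝ maps 𝒮 A n into 𝒮 A m.
  _IsRestrictionOf_ : 𝒮 A n ⟶ₛ 𝒮 A m → Ŝ A n ⟶ₛ Ŝ A m → Set
  G IsRestrictionOf Ĝ =
    ∀ r → inclusion {A} {m} (Func.to G r) ≈ Func.to Ĝ (inclusion {A} {n} r)
    where open Setoid (Ŝ A m) using (_≈_)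

-- (1) The values of Ĝ (θ i) are semidecidable uniformly in i, so (QGN II)
-- yields an index for Ĝ (θ i).
--
-- (2) Let K be the c.e. set of those i that belong to the range of θ i, where θ
-- is the unary numbering.  Its complement is not c.e.: it would be the range of
-- some θ j.  If p ⊑ r, then (QGN II) gives indices, computable in i, of
-- functions that equal r if i ∈ K and p otherwise.  If G p had a value that G r
-- has not, that value would therefore semidecide the complement of K; hence G
-- is monotone.  Enumerating a total r on larger and larger cubes until i turns
-- up in K gives a finite part of r if i ∈ K and r otherwise, so in the same way
-- every value of G r is already a value of G p for a finite p ⊑ r.  Hence G
-- extends to arbitrary total q by taking the union of G p over the finite
-- p ⊑ q.  These p form a chain, which makes the union a function whose domain
-- is again a cube or everything.

module Submission where

open import Defs
open import Level using (0ℓ)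
open import Axiom.ExcludedMiddle using (ExcludedMiddle)
open import Data.Empty using (⊥-elim)
open import Data.Bool.Base using (if_then_else_)
open import Data.Nat.Base using (ℕ; zero; suc; pred; _+_; _∸_; _⊔_; _≤_; _<_; z≤n; s≤s; s≤s⁻¹; NonZero)
open import Data.Nat.Properties
open import Data.Nat.Induction using (<-rec)
open import Data.List.Base as List using (List; []; _∷_; length)
open import Data.List.Relation.Unary.Any using (Any; here; there)
open import Data.List.Membership.Propositional using (find) renaming (_∈_ to _∈ᴸ_)
open import Data.List.Membership.Propositional.Properties using (∈-upTo⁺; ∈-cartesianProductWith⁺)
import Data.List.Relation.Unary.All as Listᴬ
open Listᴬ using ([]; _∷_)
open import Data.Fin.Base using (Fin; zero; suc)
open import Data.Vec.Base using (Vec; []; _∷_; tail; lookup; tabulate)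
open import Data.Vec.N-ary using (_$ⁿ_)
open import Data.Vec.Properties using (tabulate∘lookup)
open import Data.Vec.Relation.Unary.All as All using (All; []; _∷_)
open import Data.Maybe.Base using (Maybe; just; nothing)
open import Data.Maybe.Properties using (just-injective)
import Data.Vec.Relation.Binary.Pointwise.Inductive as Pointwise
open Pointwise using (Pointwise; []; _∷_)
open import Data.Product.Base using (Σ; ∃; ∃₂; _×_; _,_; proj₁; proj₂)
open import Data.Sum.Base as Sum using (_⊎_; inj₁; inj₂; [_,_]′)
open import Function.Base using (_∘_; id)
open import Function.Bundles using (Func; Surjection; _⟶ₛ_)
open import Relation.Binary.PropositionalEquality using (_≡_; _≗_; refl; sym; trans; cong; cong₂; subst; subst₂; module ≡-Reasoning)
open import Relation.Binary.Bundles using (Setoid)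
open import Relation.Nullary using (¬_; Dec; yes; no; does; contradiction)
open import Relation.Nullary.Decidable using (map′; decidable-stable)
open import Relation.Unary using (Pred; _∈_; _≐_; _∪_)

private variable
  k n : ℕ

-- Computable functions

ComputableVec : (Vec ℕ n → Vec ℕ k) → Set
ComputableVec {n} {k} F =
  Σ (Vec (μRec n) k) λ es → ∀ xs → Pointwise (λ e y → e [ xs ]⇓ y) es (F xs)

module _ {f g : Vec ℕ n → ℕ} where

  Computable-cong : f ≗ g → Computable f → Computable g
  Computable-cong f≗g (e , e⇓) = e , λ xs → subst (e [ xs ]⇓_) (f≗g xs) (e⇓ xs)

module _ {f : Vec ℕ k → ℕ} {F : Vec ℕ n → Vec ℕ k} where

  infixr 4 _∘ᶜ_
  _∘ᶜ_ : Computable f → ComputableVec F → Computable (f ∘ F)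
  (e , e⇓) ∘ᶜ (es , es⇓) = comp e es , λ xs → comp⇓ (es⇓ xs) (e⇓ (F xs))

infixr 6 _∘ᵛ_
_∘ᵛ_ : ∀ {l} {F : Vec ℕ k → Vec ℕ l} {G : Vec ℕ n → Vec ℕ k} →
       ComputableVec F → ComputableVec G → ComputableVec (F ∘ G)
_∘ᵛ_ {G = G} (es , es⇓) (ds , ds⇓) = compAll es , λ xs → compAll⇓ (ds⇓ xs) (es⇓ (G xs))
  where
  compAll : ∀ {l} → Vec (μRec _) l → Vec (μRec _) l
  compAll []       = []
  compAll (e ∷ es) = comp e ds ∷ compAll es

  compAll⇓ : ∀ {l xs ys} {zs : Vec ℕ l} {es : Vec (μRec _) l} → Pointwise (λ e y → e [ xs ]⇓ y) ds ys →
             Pointwise (λ e z → e [ ys ]⇓ z) es zs → Pointwise (λ e z → e [ xs ]⇓ z) (compAll es) zs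
  compAll⇓ ds⇓ []         = []
  compAll⇓ ds⇓ (e⇓ ∷ es⇓) = comp⇓ ds⇓ e⇓ ∷ compAll⇓ ds⇓ es⇓

[]ᶜ : ComputableVec {n} (λ _ → [])
[]ᶜ = [] , λ _ → []

infixr 5 _∷ᶜ_
_∷ᶜ_ : {f : Vec ℕ n → ℕ} {F : Vec ℕ n → Vec ℕ k} →
       Computable f → ComputableVec F → ComputableVec (λ xs → f xs ∷ F xs)
(e , e⇓) ∷ᶜ (es , es⇓) = e ∷ es , λ xs → e⇓ xs ∷ es⇓ xs

idᶜ : ComputableVec {n} id
idᶜ = tabulate proj , λ xs →
  subst (Pointwise _ _) (tabulate∘lookup xs) (Pointwise.tabulate⁺ proj⇓)

tailᶜ : {F : Vec ℕ n → Vec ℕ (suc k)} → ComputableVec F → ComputableVec (tail ∘ F)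
tailᶜ {F = F} (_ ∷ es , es⇓) = es , λ xs → tail-pointwise (F xs) (es⇓ xs)
  where
  tail-pointwise : ∀ {A B : Set} {_∼_ : A → B → Set} {k x} {xs : Vec A k} (ys : Vec B (suc k)) →
                   Pointwise _∼_ (x ∷ xs) ys → Pointwise _∼_ xs (tail ys)
  tail-pointwise (_ ∷ _) (_ ∷ ps) = ps

var : (i : Fin n) → Computable (λ xs → lookup xs i)
var i = proj i , λ _ → proj⇓ i

pattern 0F = zero
pattern 1F = suc zero
pattern 2F = suc (suc zero)
pattern 3F = suc (suc (suc zero))

module _ {f : ℕ → ℕ} {g : Vec ℕ n → ℕ} where

  ap₁ : Computableⁿ 1 f → Computable g → Computable (f ∘ g)
  ap₁ f-comp g-comp = f-comp ∘ᶜ g-comp ∷ᶜ []ᶜ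

module _ {f : ℕ → ℕ → ℕ} {g h : Vec ℕ n → ℕ} where

  ap₂ : Computableⁿ 2 f → Computable g → Computable h → Computable (λ xs → f (g xs) (h xs))
  ap₂ f-comp g-comp h-comp = f-comp ∘ᶜ g-comp ∷ᶜ h-comp ∷ᶜ []ᶜ

suc-computable : Computableⁿ 1 suc
suc-computable = succ , λ { (_ ∷ []) → succ⇓ }

const : (c : ℕ) → Computable {n} (λ _ → c)
const zero    = zer , λ _ → zer⇓
const (suc c) = ap₁ suc-computable (const c)

computable₁ : {f : ℕ → ℕ} → Computable {1} (λ xs → f (lookup xs 0F)) → Computableⁿ 1 f
computable₁ = Computable-cong λ { (_ ∷ []) → refl }

computable₂ : {f : ℕ → ℕ → ℕ} →
              Computable {2} (λ xs → f (lookup xs 0F) (lookup xs 1F)) → Computableⁿ 2 f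
computable₂ = Computable-cong λ { (_ ∷ _ ∷ []) → refl }

primRec : (Vec ℕ n → ℕ) → (Vec ℕ (suc (suc n)) → ℕ) → ℕ → Vec ℕ n → ℕ
primRec b s zero    xs = b xs
primRec b s (suc m) xs = s (m ∷ primRec b s m xs ∷ xs)

primRecᶜ : {b : Vec ℕ n → ℕ} {s : Vec ℕ (suc (suc n)) → ℕ} {F : Vec ℕ k → ℕ} {G : Vec ℕ k → Vec ℕ n} →
           Computable b → Computable s → Computable F → ComputableVec G →
           Computable (λ xs → primRec b s (F xs) (G xs))
primRecᶜ {n} {b = b} {s} (eb , eb⇓) (es , es⇓) F-comp G-comp =
  _∘ᶜ_ {f = rec} (prec eb es , λ { (m ∷ xs) → rec⇓ m xs }) (F-comp ∷ᶜ G-comp)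
  where
  rec : Vec ℕ (suc n) → ℕ
  rec (m ∷ xs) = primRec b s m xs

  rec⇓ : ∀ m xs → prec eb es [ m ∷ xs ]⇓ primRec b s m xs
  rec⇓ zero    xs = prec⇓zero (eb⇓ xs)
  rec⇓ (suc m) xs = prec⇓suc (rec⇓ m xs) (es⇓ _)

pred-computable : Computableⁿ 1 pred
pred-computable = Computable-cong (λ { (zero ∷ []) → refl ; (suc _ ∷ []) → refl })
  (primRecᶜ {n = 0} (const 0) (var 0F) (var 0F) []ᶜ)

+-computable : Computableⁿ 2 _+_
+-computable = Computable-cong (λ { (m ∷ n ∷ []) → correct m n })
  (primRecᶜ {n = 1} (var 0F) (ap₁ suc-computable (var 1F)) (var 0F) (var 1F ∷ᶜ []ᶜ))
  where
  correct : ∀ m n → primRec {1} (λ xs → lookup xs 0F) (λ xs → suc (lookup xs 1F)) m (n ∷ []) ≡ m + n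
  correct zero    n = refl
  correct (suc m) n = cong suc (correct m n)

∸-computable : Computableⁿ 2 _∸_
∸-computable = Computable-cong (λ { (m ∷ n ∷ []) → correct m n })
  (primRecᶜ {n = 1} (var 0F) (ap₁ pred-computable (var 1F)) (var 1F) (var 0F ∷ᶜ []ᶜ))
  where
  correct : ∀ m n → primRec {1} (λ xs → lookup xs 0F) (λ xs → pred (lookup xs 1F)) n (m ∷ []) ≡ m ∸ n
  correct m zero    = refl
  correct m (suc n) = trans (cong pred (correct m n)) (pred[m∸n]≡m∸[1+n] m n)

-- Computably decidable relations

-- The value 0 stands for truth. Conjunction then becomes addition, and `mini`, which looks for a
-- zero, finds the least solution.
record Δ₁ (R : Vec ℕ n → Set) : Set where
  field
    χ            : Vec ℕ n → ℕ
    χ-computable : Computable χ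
    sound        : ∀ xs → χ xs ≡ 0 → R xs
    complete     : ∀ xs → R xs → χ xs ≡ 0

  decide : ∀ xs → Dec (R xs)
  decide xs = map′ (sound xs) (complete xs) (χ xs ≟ 0)

open Δ₁

module _ {R S : Vec ℕ n → Set} where

  Δ₁-map : (∀ xs → R xs → S xs) → (∀ xs → S xs → R xs) → Δ₁ R → Δ₁ S
  Δ₁-map R⇒S S⇒R R-Δ₁ = record
    { χ            = χ R-Δ₁
    ; χ-computable = χ-computable R-Δ₁
    ; sound        = λ xs → R⇒S xs ∘ sound R-Δ₁ xs
    ; complete     = λ xs → complete R-Δ₁ xs ∘ S⇒R xs
    }

  Δ₁-× : Δ₁ R → Δ₁ S → Δ₁ (λ xs → R xs × S xs)
  Δ₁-× R-Δ₁ S-Δ₁ = record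
    { χ            = λ xs → χ R-Δ₁ xs + χ S-Δ₁ xs
    ; χ-computable = ap₂ +-computable (χ-computable R-Δ₁) (χ-computable S-Δ₁)
    ; sound        = λ xs eq → sound R-Δ₁ xs (m+n≡0⇒m≡0 _ eq) ,
                               sound S-Δ₁ xs (m+n≡0⇒n≡0 (χ R-Δ₁ xs) eq)
    ; complete     = λ xs (r , s) → cong₂ _+_ (complete R-Δ₁ xs r) (complete S-Δ₁ xs s)
    }

Δ₁-¬ : {R : Vec ℕ n → Set} → Δ₁ R → Δ₁ (λ xs → ¬ R xs)
Δ₁-¬ R-Δ₁ = record
  { χ            = λ xs → 1 ∸ χ R-Δ₁ xs
  ; χ-computable = ap₂ ∸-computable (const 1) (χ-computable R-Δ₁)
  ; sound        = λ xs eq r → contradiction (trans (sym eq) (cong (1 ∸_) (complete R-Δ₁ xs r))) λ ()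
  ; complete     = λ xs ¬r → m≤n⇒m∸n≡0 (n≢0⇒n>0 (¬r ∘ sound R-Δ₁ xs))
  }

-- De Morgan reduces this to conjunction and negation; as both sides are decidable, the double
-- negation can be removed.
Δ₁-⊎ : {R S : Vec ℕ n → Set} → Δ₁ R → Δ₁ S → Δ₁ (λ xs → R xs ⊎ S xs)
Δ₁-⊎ R-Δ₁ S-Δ₁ = Δ₁-map
  (λ xs ¬[¬r×¬s] → decidable-stable (decide R-Δ₁ xs ⊎-dec decide S-Δ₁ xs)
                     λ ¬[r⊎s] → ¬[¬r×¬s] (¬[r⊎s] ∘ inj₁ , ¬[r⊎s] ∘ inj₂))
  (λ xs r⊎s (¬r , ¬s) → [ ¬r , ¬s ]′ r⊎s)
  (Δ₁-¬ (Δ₁-× (Δ₁-¬ R-Δ₁) (Δ₁-¬ S-Δ₁)))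
  where open import Relation.Nullary.Decidable using (_⊎-dec_)

Δ₁-sub : {R : Vec ℕ k → Set} {F : Vec ℕ n → Vec ℕ k} → Δ₁ R → ComputableVec F → Δ₁ (R ∘ F)
Δ₁-sub {F = F} R-Δ₁ F-comp = record
  { χ            = χ R-Δ₁ ∘ F
  ; χ-computable = χ-computable R-Δ₁ ∘ᶜ F-comp
  ; sound        = λ xs → sound R-Δ₁ (F xs)
  ; complete     = λ xs → complete R-Δ₁ (F xs)
  }

module _ {f g : Vec ℕ n → ℕ} (f-comp : Computable f) (g-comp : Computable g) where

  Δ₁-< : Δ₁ (λ xs → f xs < g xs)
  Δ₁-< = record
    { χ            = λ xs → suc (f xs) ∸ g xs
    ; χ-computable = ap₂ ∸-computable (ap₁ suc-computable f-comp) g-comp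
    ; sound        = λ xs → m∸n≡0⇒m≤n
    ; complete     = λ xs → m≤n⇒m∸n≡0
    }

  Δ₁-≡ : Δ₁ (λ xs → f xs ≡ g xs)
  Δ₁-≡ = record
    { χ            = λ xs → (f xs ∸ g xs) + (g xs ∸ f xs)
    ; χ-computable = ap₂ +-computable (ap₂ ∸-computable f-comp g-comp) (ap₂ ∸-computable g-comp f-comp)
    ; sound        = λ xs eq → ≤-antisym (m∸n≡0⇒m≤n (m+n≡0⇒m≡0 _ eq))
                                         (m∸n≡0⇒m≤n (m+n≡0⇒n≡0 (f xs ∸ g xs) eq))
    ; complete     = λ xs eq → cong₂ _+_ (m≤n⇒m∸n≡0 (≤-reflexive eq))
                                         (m≤n⇒m∸n≡0 (≤-reflexive (sym eq)))
    }

module _ {R : Vec ℕ (suc n) → Set} {b : Vec ℕ n → ℕ} where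

  -- A sum of natural numbers vanishes exactly if all its terms do, so summing `χ` below the bound
  -- decides the quantifier.
  Δ₁-∀< : Δ₁ R → Computable b → Δ₁ (λ xs → ∀ x → x < b xs → R (x ∷ xs))
  Δ₁-∀< R-Δ₁ b-comp = record
    { χ            = λ xs → sumBelow (b xs) xs
    ; χ-computable = primRecᶜ (const 0)
                       (ap₂ +-computable (var 1F) (χ-computable R-Δ₁ ∘ᶜ var 0F ∷ᶜ tailᶜ (tailᶜ idᶜ)))
                       b-comp idᶜ
    ; sound        = λ xs eq x x<b → sound R-Δ₁ _ (sumBelow≡0⇒ (b xs) eq x x<b)
    ; complete     = λ xs r → ⇒sumBelow≡0 (b xs) λ x x<b → complete R-Δ₁ _ (r x x<b)
    }
    where
    sumBelow : ℕ → Vec ℕ n → ℕ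
    sumBelow = primRec (λ _ → 0) λ ys → lookup ys 1F + χ R-Δ₁ (lookup ys 0F ∷ tail (tail ys))

    sumBelow≡0⇒ : ∀ {xs} b → sumBelow b xs ≡ 0 → ∀ x → x < b → χ R-Δ₁ (x ∷ xs) ≡ 0
    sumBelow≡0⇒ {xs} (suc b) eq x x<1+b with m<1+n⇒m<n∨m≡n x<1+b
    ... | inj₁ x<b  = sumBelow≡0⇒ b (m+n≡0⇒m≡0 _ eq) x x<b
    ... | inj₂ refl = m+n≡0⇒n≡0 (sumBelow b xs) eq

    ⇒sumBelow≡0 : ∀ {xs} b → (∀ x → x < b → χ R-Δ₁ (x ∷ xs) ≡ 0) → sumBelow b xs ≡ 0
    ⇒sumBelow≡0 zero    _  = refl
    ⇒sumBelow≡0 (suc b) eq = cong₂ _+_ (⇒sumBelow≡0 b λ x → eq x ∘ m<n⇒m<1+n) (eq b ≤-refl)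

Δ₁-∃< : {R : Vec ℕ (suc n) → Set} {b : Vec ℕ n → ℕ} →
        Δ₁ R → Computable b → Δ₁ (λ xs → ∃ λ x → x < b xs × R (x ∷ xs))
Δ₁-∃< {b = b} R-Δ₁ b-comp = Δ₁-map
  (λ xs ¬∀¬ → decidable-stable (anyUpTo? (λ x → decide R-Δ₁ (x ∷ xs)) (b xs))
                λ ¬∃ → ¬∀¬ λ x x<b r → ¬∃ (x , x<b , r))
  (λ xs (x , x<b , r) ∀¬ → ∀¬ x x<b r)
  (Δ₁-¬ (Δ₁-∀< (Δ₁-¬ R-Δ₁) b-comp))

-- Unbounded search for the value: the only zero of `χ` at `xs` is `f xs`, and all smaller
-- candidates give positive values, as `mini⇓` demands.
Δ₁-graph⇒computable : {f : Vec ℕ n → ℕ} → Δ₁ (λ xs → lookup xs 0F ≡ f (tail xs)) → Computable f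
Δ₁-graph⇒computable {f = f} f-Δ₁ = mini (proj₁ (χ-computable f-Δ₁)) , λ xs →
  mini⇓ (subst (_ [ _ ]⇓_) (complete f-Δ₁ (f xs ∷ xs) refl) (proj₂ (χ-computable f-Δ₁) _))
        λ z z<fxs → positive xs z (<⇒≢ z<fxs) _ refl
  where
  positive : ∀ xs z → ¬ z ≡ f xs → ∀ c → χ f-Δ₁ (z ∷ xs) ≡ c →
             ∃ λ w → proj₁ (χ-computable f-Δ₁) [ z ∷ xs ]⇓ suc w
  positive xs z z≢fxs zero    eq = contradiction (sound f-Δ₁ (z ∷ xs) eq) z≢fxs
  positive xs z z≢fxs (suc w) eq = w , subst (_ [ _ ]⇓_) eq (proj₂ (χ-computable f-Δ₁) _)

cond : {A : Set} → ℕ → A → A → A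
cond zero    x y = x
cond (suc _) x y = y

cond-idem : {A : Set} (c : ℕ) {x : A} → cond c x x ≡ x
cond-idem zero    = refl
cond-idem (suc _) = refl

cond-computable : {f g h : Vec ℕ n → ℕ} → Computable f → Computable g → Computable h →
                  Computable (λ xs → cond (f xs) (g xs) (h xs))
cond-computable {f = f} {g} {h} f-comp g-comp h-comp = Computable-cong (λ xs → correct xs (f xs))
  (primRecᶜ g-comp (h-comp ∘ᶜ tailᶜ (tailᶜ idᶜ)) f-comp idᶜ)
  where
  correct : ∀ xs m → primRec g (λ ys → h (tail (tail ys))) m xs ≡ cond m (g xs) (h xs)
  correct xs zero    = refl
  correct xs (suc m) = refl

-- Searching and maximising

leastWitness : {Q : ℕ → Set} → (∀ x → Dec (Q x)) → ∃ Q →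
               ∃ λ x → Q x × (∀ y → y < x → ¬ Q y)
leastWitness {Q} Q? (x , q) = <-rec _ search x q
  where
  search : ∀ x → (∀ {y} → y < x → Q y → _) → Q x → _
  search x rec q with anyUpTo? Q? x
  ... | yes (y , y<x , qy) = rec y<x qy
  ... | no  ¬below         = x , q , λ y y<x qy → ¬below (y , y<x , qy)

argmax : (f : ℕ → ℕ) → ∀ N → ∃ λ x → x ≤ N × (∀ {y} → y ≤ N → f y ≤ f x)
argmax f zero    = 0 , z≤n , λ { z≤n → ≤-refl }
argmax f (suc N) with argmax f N
... | x , x≤N , max with ≤-total (f x) (f (suc N))
... | inj₁ fx≤ = suc N , ≤-refl , λ y≤1+N → [ (λ { (s≤s y≤N) → ≤-trans (max y≤N) fx≤ }) , (λ { refl → ≤-refl }) ]′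
                                              (m≤n⇒m<n∨m≡n y≤1+N)
... | inj₂ ≤fx = x , m≤n⇒m≤1+n x≤N , λ y≤1+N → [ (λ { (s≤s y≤N) → max y≤N }) , (λ { refl → ≤fx }) ]′
                                                 (m≤n⇒m<n∨m≡n y≤1+N)

-- `T` need not be decidable, so excluded middle tells whether the bound is attained; if it is not,
-- the bound is lowered by one.
maximum : ExcludedMiddle 0ℓ → {T : ℕ → Set} → ∃ T → ∀ N → (∀ {b} → T b → b ≤ N) →
          ∃ λ b → T b × (∀ {c} → T c → c ≤ b)
maximum em (b , t) zero    bound = b , t , λ tc → ≤-trans (bound tc) z≤n
maximum em {T} t   (suc N) bound with em {T (suc N)}
... | yes t₁ = suc N , t₁ , bound
... | no ¬t₁ = maximum em t N λ tb → s≤s⁻¹ (≤∧≢⇒< (bound tb) λ { refl → ¬t₁ tb })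

maybe-ext : {A : Set} {x y : Maybe A} → (∀ {z} → x ≡ just z → y ≡ just z) →
            (∀ {z} → y ≡ just z → x ≡ just z) → x ≡ y
maybe-ext {x = just _}                x⇒y y⇒x = sym (x⇒y refl)
maybe-ext {x = nothing} {y = just _}  x⇒y y⇒x = y⇒x refl
maybe-ext {x = nothing} {y = nothing} x⇒y y⇒x = refl

-- Semidecidable relations

module Semidecidability (P : Pairing) where
  open Pairing P

  unpair : ∀ w → ∃ λ xy → ⟨ proj₁ xy , proj₂ xy ⟩ ≡ w
  unpair w with xy , eq ← proj₂ bijective w = xy , eq refl

  π₁ π₂ : ℕ → ℕ
  π₁ w = proj₁ (proj₁ (unpair w))
  π₂ w = proj₂ (proj₁ (unpair w))

  ⟨π₁,π₂⟩ : ∀ w → ⟨ π₁ w , π₂ w ⟩ ≡ w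
  ⟨π₁,π₂⟩ w = proj₂ (unpair w)

  unpair-⟨⟩ : ∀ x y → proj₁ (unpair ⟨ x , y ⟩) ≡ (x , y)
  unpair-⟨⟩ x y = proj₁ bijective (⟨π₁,π₂⟩ ⟨ x , y ⟩)

  π₁-⟨⟩ : ∀ x y → π₁ ⟨ x , y ⟩ ≡ x
  π₁-⟨⟩ x y = cong proj₁ (unpair-⟨⟩ x y)

  π₂-⟨⟩ : ∀ x y → π₂ ⟨ x , y ⟩ ≡ y
  π₂-⟨⟩ x y = cong proj₂ (unpair-⟨⟩ x y)

  π₁≤ : ∀ w → π₁ w ≤ w
  π₁≤ w = ≤-trans (≥-left (π₁ w) (π₂ w)) (≤-reflexive (⟨π₁,π₂⟩ w))

  π₂≤ : ∀ w → π₂ w ≤ w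
  π₂≤ w = ≤-trans (≥-right (π₁ w) (π₂ w)) (≤-reflexive (⟨π₁,π₂⟩ w))

  -- Both components of a pair are at most its code, so a bounded search for the other component
  -- decides the graph.
  π₁-computable : Computableⁿ 1 π₁
  π₁-computable = computable₁ (Δ₁-graph⇒computable (Δ₁-map
    (λ { (x ∷ w ∷ []) (y , _ , eq) → trans (sym (π₁-⟨⟩ x y)) (cong π₁ eq) })
    (λ { (x ∷ w ∷ []) refl → π₂ w , s≤s (π₂≤ w) , ⟨π₁,π₂⟩ w })
    (Δ₁-∃< (Δ₁-≡ (ap₂ computable (var 1F) (var 0F)) (var 2F)) (ap₁ suc-computable (var 1F)))))

  π₂-computable : Computableⁿ 1 π₂
  π₂-computable = computable₁ (Δ₁-graph⇒computable (Δ₁-map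
    (λ { (y ∷ w ∷ []) (x , _ , eq) → trans (sym (π₂-⟨⟩ x y)) (cong π₂ eq) })
    (λ { (y ∷ w ∷ []) refl → π₁ w , s≤s (π₁≤ w) , ⟨π₁,π₂⟩ w })
    (Δ₁-∃< (Δ₁-≡ (ap₂ computable (var 0F) (var 1F)) (var 2F)) (ap₁ suc-computable (var 1F)))))

  -- A projection of a decidable relation along its first argument. The matrix is kept as data
  -- because its witnesses later serve as the stages at which a number enters `K`.
  record Σ₁ (R : Vec ℕ n → Set) : Set₁ where
    field
      matrix    : Vec ℕ (suc n) → Set
      matrix-Δ₁ : Δ₁ matrix
      ∃⇒        : ∀ xs t → matrix (t ∷ xs) → R xs
      ⇒∃        : ∀ xs → R xs → ∃ λ t → matrix (t ∷ xs)

  open Σ₁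

  Σ₁-map : {R S : Vec ℕ n → Set} → (∀ xs → R xs → S xs) → (∀ xs → S xs → R xs) → Σ₁ R → Σ₁ S
  Σ₁-map R⇒S S⇒R R-Σ₁ = record
    { matrix    = matrix R-Σ₁
    ; matrix-Δ₁ = matrix-Δ₁ R-Σ₁
    ; ∃⇒        = λ xs t → R⇒S xs ∘ ∃⇒ R-Σ₁ xs t
    ; ⇒∃        = λ xs → ⇒∃ R-Σ₁ xs ∘ S⇒R xs
    }

  Δ₁⇒Σ₁ : {R : Vec ℕ n → Set} → Δ₁ R → Σ₁ R
  Δ₁⇒Σ₁ {R = R} R-Δ₁ = record
    { matrix    = R ∘ tail
    ; matrix-Δ₁ = Δ₁-sub R-Δ₁ (tailᶜ idᶜ)
    ; ∃⇒        = λ xs t → id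
    ; ⇒∃        = λ xs r → 0 , r
    }

  Σ₁-sub : {R : Vec ℕ k → Set} {F : Vec ℕ n → Vec ℕ k} → Σ₁ R → ComputableVec F → Σ₁ (R ∘ F)
  Σ₁-sub {F = F} R-Σ₁ F-comp = record
    { matrix    = λ ys → matrix R-Σ₁ (lookup ys 0F ∷ F (tail ys))
    ; matrix-Δ₁ = Δ₁-sub (matrix-Δ₁ R-Σ₁) (var 0F ∷ᶜ F-comp ∘ᵛ tailᶜ idᶜ)
    ; ∃⇒        = λ xs → ∃⇒ R-Σ₁ (F xs)
    ; ⇒∃        = λ xs → ⇒∃ R-Σ₁ (F xs)
    }

  module _ {R : Vec ℕ (suc n) → Set} (R-Σ₁ : Σ₁ R) where

    -- Two existential quantifiers merge into one: the witness codes `x` together with a witness for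
    -- it.
    Σ₁-∃ : Σ₁ (λ xs → ∃ λ x → R (x ∷ xs))
    Σ₁-∃ = record
      { matrix    = λ ys → matrix R-Σ₁ (π₂ (lookup ys 0F) ∷ π₁ (lookup ys 0F) ∷ tail ys)
      ; matrix-Δ₁ = Δ₁-sub (matrix-Δ₁ R-Σ₁)
                      (ap₁ π₂-computable (var 0F) ∷ᶜ ap₁ π₁-computable (var 0F) ∷ᶜ tailᶜ idᶜ)
      ; ∃⇒        = λ xs t m → π₁ t , ∃⇒ R-Σ₁ (π₁ t ∷ xs) (π₂ t) m
      ; ⇒∃        = λ { xs (x , r) → let t , m = ⇒∃ R-Σ₁ (x ∷ xs) r in
                        ⟨ x , t ⟩ , subst (λ (x , t) → matrix R-Σ₁ (t ∷ x ∷ xs))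
                                          (sym (unpair-⟨⟩ x t)) m }
      }

    -- The witnesses for the finitely many x < b have a common bound.
    Σ₁-∀< : {b : Vec ℕ n → ℕ} → Computable b → Σ₁ (λ xs → ∀ x → x < b xs → R (x ∷ xs))
    Σ₁-∀< {b = b} b-comp = record
      { matrix    = λ ys → ∀ x → x < b (tail ys) →
                           ∃ λ t → t < lookup ys 0F × matrix R-Σ₁ (t ∷ x ∷ tail ys)
      ; matrix-Δ₁ = Δ₁-∀<
          (Δ₁-∃< (Δ₁-sub (matrix-Δ₁ R-Σ₁) (var 0F ∷ᶜ var 1F ∷ᶜ tailᶜ (tailᶜ (tailᶜ idᶜ)))) (var 1F))
          (b-comp ∘ᶜ tailᶜ idᶜ)
      ; ∃⇒        = λ xs t m x x<b → let t , _ , mt = m x x<b in ∃⇒ R-Σ₁ (x ∷ xs) t mt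
      ; ⇒∃        = λ xs r → collect xs (b xs) (λ x x<b → ⇒∃ R-Σ₁ (x ∷ xs) (r x x<b))
      }
      where
      collect : ∀ xs b → (∀ x → x < b → ∃ λ t → matrix R-Σ₁ (t ∷ x ∷ xs)) →
                ∃ λ T → ∀ x → x < b → ∃ λ t → t < T × matrix R-Σ₁ (t ∷ x ∷ xs)
      collect xs zero    _ = 0 , λ _ ()
      collect xs (suc b) m with collect xs b (λ x → m x ∘ m<n⇒m<1+n) | m b ≤-refl
      ... | T , bounded | t , mt = T ⊔ suc t , λ x x<1+b → enlarge x (m<1+n⇒m<n∨m≡n x<1+b)
        where
        enlarge : ∀ x → x < b ⊎ x ≡ b → ∃ λ t′ → t′ < T ⊔ suc t × matrix R-Σ₁ (t′ ∷ x ∷ xs)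
        enlarge x (inj₁ x<b)  = let t′ , t′<T , mt′ = bounded x x<b in t′ , m≤n⇒m≤n⊔o (suc t) t′<T , mt′
        enlarge x (inj₂ refl) = t , m≤n⊔m T (suc t) , mt

  module _ {R S : Vec ℕ n → Set} (R-Σ₁ : Σ₁ R) (S-Σ₁ : Σ₁ S) where

    Σ₁-× : Σ₁ (λ xs → R xs × S xs)
    Σ₁-× = record
      { matrix    = λ ys → matrix R-Σ₁ (π₁ (lookup ys 0F) ∷ tail ys) ×
                           matrix S-Σ₁ (π₂ (lookup ys 0F) ∷ tail ys)
      ; matrix-Δ₁ = Δ₁-× (Δ₁-sub (matrix-Δ₁ R-Σ₁) (ap₁ π₁-computable (var 0F) ∷ᶜ tailᶜ idᶜ))
                         (Δ₁-sub (matrix-Δ₁ S-Σ₁) (ap₁ π₂-computable (var 0F) ∷ᶜ tailᶜ idᶜ))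
      ; ∃⇒        = λ xs t (mr , ms) → ∃⇒ R-Σ₁ xs _ mr , ∃⇒ S-Σ₁ xs _ ms
      ; ⇒∃        = λ xs (r , s) → let t , mr = ⇒∃ R-Σ₁ xs r
                                       u , ms = ⇒∃ S-Σ₁ xs s in
                      ⟨ t , u ⟩ , subst (λ t → matrix R-Σ₁ (t ∷ xs)) (sym (π₁-⟨⟩ t u)) mr ,
                                  subst (λ u → matrix S-Σ₁ (u ∷ xs)) (sym (π₂-⟨⟩ t u)) ms
      }

    Σ₁-⊎ : Σ₁ (λ xs → R xs ⊎ S xs)
    Σ₁-⊎ = record
      { matrix    = λ ys → matrix R-Σ₁ ys ⊎ matrix S-Σ₁ ys
      ; matrix-Δ₁ = Δ₁-⊎ (matrix-Δ₁ R-Σ₁) (matrix-Δ₁ S-Σ₁)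
      ; ∃⇒        = λ xs t → Sum.map (∃⇒ R-Σ₁ xs t) (∃⇒ S-Σ₁ xs t)
      ; ⇒∃        = λ xs → [ (λ r → let t , m = ⇒∃ R-Σ₁ xs r in t , inj₁ m)
                           , (λ s → let t , m = ⇒∃ S-Σ₁ xs s in t , inj₂ m) ]′
      }

  -- The search runs over codes of a value together with a witness. The least such code is
  -- determined by `xs` and has a decidable graph; its first component is the value.
  Σ₁-graph⇒computable : {f : Vec ℕ n → ℕ} → Σ₁ (λ ys → lookup ys 0F ≡ f (tail ys)) → Computable f
  Σ₁-graph⇒computable {n} {f} f-Σ₁ = Computable-cong π₁-search≗f (ap₁ π₁-computable search-computable)
    where
    Q : ℕ → Vec ℕ n → Set
    Q u xs = matrix f-Σ₁ (π₂ u ∷ π₁ u ∷ xs)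

    Q-Δ₁ : Δ₁ {suc n} (λ ys → Q (lookup ys 0F) (tail ys))
    Q-Δ₁ = Δ₁-sub (matrix-Δ₁ f-Σ₁) (ap₁ π₂-computable (var 0F) ∷ᶜ ap₁ π₁-computable (var 0F) ∷ᶜ tailᶜ idᶜ)

    Least : ℕ → Vec ℕ n → Set
    Least u xs = Q u xs × (∀ t → t < u → ¬ Q t xs)

    least : ∀ xs → ∃ λ u → Least u xs
    least xs with t , m ← ⇒∃ f-Σ₁ (f xs ∷ xs) refl =
      leastWitness (λ u → decide Q-Δ₁ (u ∷ xs))
        (⟨ f xs , t ⟩ , subst (λ (z , t) → matrix f-Σ₁ (t ∷ z ∷ xs)) (sym (unpair-⟨⟩ (f xs) t)) m)

    least-unique : ∀ {u u′ xs} → Least u xs → Least u′ xs → u ≡ u′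
    least-unique {u} {u′} (q , below) (q′ , below′) =
      ≤-antisym (≮⇒≥ λ u′<u → below u′ u′<u q′) (≮⇒≥ λ u<u′ → below′ u u<u′ q)

    search-computable : Computable (proj₁ ∘ least)
    search-computable = Δ₁-graph⇒computable (Δ₁-map
      (λ { (u ∷ xs) u-least → least-unique u-least (proj₂ (least xs)) })
      (λ { (u ∷ xs) refl → proj₂ (least xs) })
      (Δ₁-× Q-Δ₁ (Δ₁-∀< (Δ₁-¬ (Δ₁-sub Q-Δ₁ (var 0F ∷ᶜ tailᶜ (tailᶜ idᶜ)))) (var 0F))))

    π₁-search≗f : π₁ ∘ proj₁ ∘ least ≗ f
    π₁-search≗f xs with u , q , _ ← least xs = ∃⇒ f-Σ₁ (π₁ u ∷ xs) (π₂ u) q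

  -- An input `u` is read as a candidate with a proposed witness. If the check fails, the known
  -- member `c` is output, which keeps the enumeration total.
  Σ₁⇒range : {R : ℕ → Set} {c : ℕ} → Σ₁ {1} (λ xs → R (lookup xs 0F)) → R c →
             ∃ λ f → Computableⁿ 1 f × R ≐ Range f
  Σ₁⇒range {R} {c} R-Σ₁ rc = f , computable₁ f-computable , (⊆ , ⊇)
    where
    χ′ : ℕ → ℕ
    χ′ u = χ (matrix-Δ₁ R-Σ₁) (π₂ u ∷ π₁ u ∷ [])

    f : ℕ → ℕ
    f u = cond (χ′ u) (π₁ u) c

    f-computable : Computable {1} (λ xs → f (lookup xs 0F))
    f-computable = cond-computable
      (χ-computable (matrix-Δ₁ R-Σ₁) ∘ᶜ ap₁ π₂-computable (var 0F) ∷ᶜ ap₁ π₁-computable (var 0F) ∷ᶜ []ᶜ)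
      (ap₁ π₁-computable (var 0F)) (const c)

    ⊆ : ∀ {x} → R x → Range f x
    ⊆ {x} r with t , m ← ⇒∃ R-Σ₁ (x ∷ []) r = ⟨ x , t ⟩ , sym (trans
      (cong (λ e → cond e (π₁ ⟨ x , t ⟩) c) (trans
        (cong (λ (x , t) → χ (matrix-Δ₁ R-Σ₁) (t ∷ x ∷ [])) (unpair-⟨⟩ x t))
        (complete (matrix-Δ₁ R-Σ₁) _ m)))
      (π₁-⟨⟩ x t))

    ⊇ : ∀ {x} → Range f x → R x
    ⊇ (u , refl) with χ′ u in eq
    ... | zero  = ∃⇒ R-Σ₁ (π₁ u ∷ []) (π₂ u) (sound (matrix-Δ₁ R-Σ₁) _ eq)
    ... | suc _ = rc

  CE⇒Σ₁ : {C : Pred ℕ 0ℓ} → CE C → Σ₁ {1} (λ xs → C (lookup xs 0F))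
  CE⇒Σ₁ (inj₁ C-empty) = Σ₁-map (λ _ ()) (λ { (x ∷ _) c → contradiction c (C-empty x) })
    (Δ₁⇒Σ₁ (Δ₁-≡ (const 0) (const 1)))
  CE⇒Σ₁ (inj₂ (f , f-computable , C⊆range , range⊆C)) =
    Σ₁-map (λ xs → range⊆C) (λ xs → C⊆range)
      (Σ₁-∃ (Δ₁⇒Σ₁ (Δ₁-≡ (var 1F) (ap₁ f-computable (var 0F)))))

  -- `CE` treats the empty set separately; excluded middle tells whether `R` is empty.
  Σ₁⇒CE : ExcludedMiddle 0ℓ → {R : Pred ℕ 0ℓ} → Σ₁ {1} (λ xs → R (lookup xs 0F)) → CE R
  Σ₁⇒CE em {R} R-Σ₁ with em {∃ R}
  ... | yes (_ , r) = inj₂ (Σ₁⇒range R-Σ₁ r)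
  ... | no  ¬r      = inj₁ λ x r → ¬r (x , r)

  -- Finite sequences

  module _ (S : SequenceCoding) where
    open SequenceCoding S using (decode; length-computable; entries-computable)

    -- A bounded quantifier over positions, since the length and the entries are computable from the
    -- code.
    Σ₁-All : {R : Vec ℕ (suc n) → Set} {a : Vec ℕ n → ℕ} → Σ₁ R → Computable a →
             Σ₁ (λ xs → Listᴬ.All (λ w → R (w ∷ xs)) (decode (a xs)))
    Σ₁-All {R = R} {a} R-Σ₁ a-comp = Σ₁-map
      (λ xs → entries⇒All (decode (a xs)))
      (λ xs → All⇒entries (decode (a xs)))
      (Σ₁-∀< (Σ₁-sub R-Σ₁ (ap₂ entries-computable (a-comp ∘ᶜ tailᶜ idᶜ) (var 0F) ∷ᶜ tailᶜ idᶜ))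
             (ap₁ length-computable a-comp))
      where
      entries⇒All : {T : ℕ → Set} → ∀ ws → (∀ j → j < length ws → T (entry ws j)) → Listᴬ.All T ws
      entries⇒All []       t = []
      entries⇒All (w ∷ ws) t = t 0 (s≤s z≤n) ∷ entries⇒All ws (λ j j< → t (suc j) (s≤s j<))

      All⇒entries : {T : ℕ → Set} → ∀ ws → Listᴬ.All T ws → ∀ j → j < length ws → T (entry ws j)
      All⇒entries (w ∷ ws) (t ∷ ts) zero    _        = t
      All⇒entries (w ∷ ws) (t ∷ ts) (suc j) (s≤s j<) = All⇒entries ws ts j j<

    Σ₁-Any : {R : Vec ℕ (suc n) → Set} {a : Vec ℕ n → ℕ} → Σ₁ R → Computable a →
             Σ₁ (λ xs → Any (λ w → R (w ∷ xs)) (decode (a xs)))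
    Σ₁-Any {R = R} {a} R-Σ₁ a-comp = Σ₁-map
      (λ xs (j , j< , r) → entry⇒Any (decode (a xs)) j j< r)
      (λ xs → Any⇒entry)
      (Σ₁-∃ (Σ₁-× (Δ₁⇒Σ₁ (Δ₁-< (var 0F) (ap₁ length-computable (a-comp ∘ᶜ tailᶜ idᶜ))))
                  (Σ₁-sub R-Σ₁ (ap₂ entries-computable (a-comp ∘ᶜ tailᶜ idᶜ) (var 0F) ∷ᶜ tailᶜ idᶜ))))
      where
      entry⇒Any : {T : ℕ → Set} → ∀ ws j → j < length ws → T (entry ws j) → Any T ws
      entry⇒Any (w ∷ ws) zero    _        t = here t
      entry⇒Any (w ∷ ws) (suc j) (s≤s j<) t = there (entry⇒Any ws j j< t)

      Any⇒entry : {T : ℕ → Set} → ∀ {ws} → Any T ws → ∃ λ j → j < length ws × T (entry ws j)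
      Any⇒entry (here t)  = 0 , s≤s z≤n , t
      Any⇒entry (there p) = let j , j< , t = Any⇒entry p in suc j , s≤s j< , t

  -- Tuples and quasi-Gödel numberings

  ⟨⟩-injective : ∀ {x y x′ y′} → ⟨ x , y ⟩ ≡ ⟨ x′ , y′ ⟩ → x ≡ x′ × y ≡ y′
  ⟨⟩-injective eq with refl ← proj₁ bijective eq = refl , refl

  tuple-∷ : ∀ {n} .{{_ : NonZero n}} x (xs : Vec ℕ n) → tuple (x ∷ xs) ≡ ⟨ x , tuple xs ⟩
  tuple-∷ x (_ ∷ _) = refl

  -- With arguments coded by single numbers, the relations below have the same arity for every `n`.
  untuple : ∀ n .{{_ : NonZero n}} → ℕ → Vec ℕ n
  untuple 1             x = x ∷ []
  untuple (suc (suc n)) x = π₁ x ∷ untuple (suc n) (π₂ x)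

  tuple-untuple : ∀ n .{{_ : NonZero n}} x → tuple (untuple n x) ≡ x
  tuple-untuple 1             x = refl
  tuple-untuple (suc (suc n)) x = trans (tuple-∷ (π₁ x) (untuple (suc n) (π₂ x)))
    (trans (cong ⟨ π₁ x ,_⟩ (tuple-untuple (suc n) (π₂ x))) (⟨π₁,π₂⟩ x))

  untuple-tuple : ∀ {n} .{{_ : NonZero n}} (xs : Vec ℕ n) → untuple n (tuple xs) ≡ xs
  untuple-tuple (x ∷ [])     = refl
  untuple-tuple (x ∷ y ∷ xs) = cong₂ _∷_ (π₁-⟨⟩ x _)
    (trans (cong (untuple _) (π₂-⟨⟩ x _)) (untuple-tuple (y ∷ xs)))

  -- Provides cubes around `xs`: every side greater than `tuple xs` will do.
  entries≤tuple : ∀ {n} .{{_ : NonZero n}} (xs : Vec ℕ n) → All (_≤ tuple xs) xs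
  entries≤tuple (x ∷ [])     = ≤-refl ∷ []
  entries≤tuple (x ∷ y ∷ xs) =
    ≥-left x _ ∷ All.map (λ z≤ → ≤-trans z≤ (≥-right x _)) (entries≤tuple (y ∷ xs))

  tuple-computable : ∀ n .{{_ : NonZero n}} → Computable {n} tuple
  tuple-computable 1             = Computable-cong (λ { (_ ∷ []) → refl }) (var 0F)
  tuple-computable (suc (suc n)) = Computable-cong (λ { (_ ∷ _ ∷ _) → refl })
    (ap₂ computable (var 0F) (tuple-computable (suc n) ∘ᶜ tailᶜ idᶜ))

  Δ₁-cube : ∀ n .{{_ : NonZero n}} {f b : Vec ℕ k → ℕ} → Computable f → Computable b →
            Δ₁ (λ xs → All (_< b xs) (untuple n (f xs)))
  Δ₁-cube 1             f-comp b-comp = Δ₁-map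
    (λ _ x<b → x<b ∷ []) (λ { _ (x<b ∷ []) → x<b }) (Δ₁-< f-comp b-comp)
  Δ₁-cube (suc (suc n)) f-comp b-comp = Δ₁-map
    (λ _ (x<b , xs<b) → x<b ∷ xs<b) (λ { _ (x<b ∷ xs<b) → x<b , xs<b })
    (Δ₁-× (Δ₁-< (ap₁ π₁-computable f-comp) b-comp)
          (Δ₁-cube (suc n) (ap₁ π₂-computable f-comp) b-comp))

  -- Unfolds into `n` nested bounded quantifiers, with the tuple code assembled from the innermost
  -- variable outwards.
  Σ₁-∀cube : ∀ n .{{_ : NonZero n}} {R : Vec ℕ (suc k) → Set} {b : Vec ℕ k → ℕ} →
             Σ₁ R → Computable b → Σ₁ (λ ys → ∀ xs → All (_< b ys) xs → R (tuple {n} xs ∷ ys))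
  Σ₁-∀cube 1             R-Σ₁ b-comp = Σ₁-map
    (λ { _ r (x ∷ []) (x<b ∷ []) → r x x<b }) (λ _ r x x<b → r (x ∷ []) (x<b ∷ []))
    (Σ₁-∀< R-Σ₁ b-comp)
  Σ₁-∀cube (suc (suc n)) {R} {b} R-Σ₁ b-comp = Σ₁-map
    (λ { _ r (x ∷ y ∷ xs) (x<b ∷ xs<b) → r x x<b (y ∷ xs) xs<b })
    (λ { _ r x x<b (y ∷ xs) xs<b → r (x ∷ y ∷ xs) (x<b ∷ xs<b) })
    (Σ₁-∀<
      (Σ₁-∀cube (suc n) {λ ys → R (⟨ lookup ys 1F , lookup ys 0F ⟩ ∷ tail (tail ys))} {b ∘ tail}
        (Σ₁-sub R-Σ₁ (ap₂ computable (var 1F) (var 0F) ∷ᶜ tailᶜ (tailᶜ idᶜ))) (b-comp ∘ᶜ tailᶜ idᶜ))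
      b-comp)

  -- The graph of q in terms of codes, which is the form in which it can
  -- be semidecided.
  _codesValueOf_ : ∀ {n} .{{_ : NonZero n}} → ℕ → PFun n → Set
  _codesValueOf_ {n} w q = q (untuple n (π₁ w)) ≡ just (π₂ w)

  module _ {n} .{{_ : NonZero n}} {q : PFun n} where

    graph⇒codesValue : ∀ {w} → graph P q w → w codesValueOf q
    graph⇒codesValue (xs , z , qxs≡z , refl) = begin
      q (untuple n (π₁ ⟨ tuple xs , z ⟩)) ≡⟨ cong (q ∘ untuple n) (π₁-⟨⟩ _ z) ⟩
      q (untuple n (tuple xs))            ≡⟨ cong q (untuple-tuple xs) ⟩
      q xs                                ≡⟨ qxs≡z ⟩
      just z                              ≡⟨ cong just (π₂-⟨⟩ _ z) ⟨
      just (π₂ ⟨ tuple xs , z ⟩)          ∎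
      where open ≡-Reasoning

    codesValue⇒graph : ∀ {w} → w codesValueOf q → graph P q w
    codesValue⇒graph {w} q≡ = untuple n (π₁ w) , π₂ w , q≡ ,
      sym (trans (cong ⟨_, π₂ w ⟩ (tuple-untuple n (π₁ w))) (⟨π₁,π₂⟩ w))

    graph⇒value : ∀ {x z} → graph P q ⟨ x , z ⟩ → q (untuple n x) ≡ just z
    graph⇒value {x} {z} = subst₂ (λ x z → q (untuple n x) ≡ just z) (π₁-⟨⟩ x z) (π₂-⟨⟩ x z) ∘ graph⇒codesValue

    value⇒graph : ∀ {x z} → q (untuple n x) ≡ just z → graph P q ⟨ x , z ⟩
    value⇒graph {x} {z} eq = untuple n x , z , eq , cong ⟨_, z ⟩ (sym (tuple-untuple n x))

  module QuasiGödel {A : Pred ℕ 0ℓ} {n : ℕ} .{{n≢0 : NonZero n}} (θ : Numbering (𝒮 A n))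
                    (θ-quasiGödel : IsQuasiGödel P θ) where
    open IsQuasiGödel θ-quasiGödel
    open Setoid (𝒮 A n) using (Carrier; _≈_)

    θ[_] : ℕ → Carrier
    θ[_] = Surjection.to θ

    index : (r : Carrier) → ∃ λ i → θ[ i ] ≈ r
    index r with i , eq ← Surjection.surjective θ r = i , eq refl

    -- By (QGN I) the extended graph of the universal function can be listed, and `z` is a value
    -- exactly if an entry with second component `suc z` appears; entries with second component 0
    -- carry no information.
    value-Σ₁ : Σ₁ {3} (λ v → proj₁ θ[ lookup v 0F ] (untuple n (lookup v 1F)) ≡ just (lookup v 2F))
    value-Σ₁ with h , h-computable , graph⊆range , range⊆graph ← QGN-I = Σ₁-map
      (λ { (i ∷ x ∷ z ∷ []) (t , eq) → sound′ (range⊆graph (t , eq)) })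
      (λ { (i ∷ x ∷ z ∷ []) eq → graph⊆range (inj₂ (i ∷ untuple n x , z , eq ,
             cong ⟨_, suc z ⟩ (sym (trans (tuple-∷ i (untuple n x)) (cong ⟨ i ,_⟩ (tuple-untuple n x)))))) })
      (Σ₁-∃ (Δ₁⇒Σ₁ (Δ₁-≡
        (ap₂ computable (ap₂ computable (var 1F) (var 2F)) (ap₁ suc-computable (var 3F)))
        (ap₁ h-computable (var 0F)))))
      where
      sound′ : ∀ {i x z} → extendedGraph P (universal θ) ⟨ ⟨ i , x ⟩ , suc z ⟩ →
               proj₁ θ[ i ] (untuple n x) ≡ just z
      sound′ (inj₁ (_ , eq)) with () ← proj₂ (⟨⟩-injective eq)
      sound′ (inj₂ (i ∷ xs , z , θixs≡z , eq))
        with eq′ , refl ← ⟨⟩-injective eq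
        with refl , refl ← ⟨⟩-injective (trans eq′ (tuple-∷ i xs)) =
        trans (cong (proj₁ θ[ i ]) (untuple-tuple xs)) θixs≡z

    -- The section of `R` at `i` is the graph of `q` with coded arguments. This is stated for one
    -- `i` at a time, because the function described may depend on whether `i` belongs to `K`.
    Represents : (Vec ℕ 3 → Set) → ℕ → PFun n → Set
    Represents R i q = ∀ x z → (q (untuple n x) ≡ just z → R (i ∷ x ∷ z ∷ [])) ×
                               (R (i ∷ x ∷ z ∷ []) → q (untuple n x) ≡ just z)

    module _ {R : Vec ℕ 3 → Set} (R-Σ₁ : Σ₁ R) where

      private
        -- Here `y` is 0 or the successor of a proposed value, and `t` is a proposed witness. A
        -- failed check yields 0, which is safe because every extended graph contains all pairs with
        -- second component 0.
        body : ℕ → ℕ → ℕ → ℕ → ℕ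
        body i x y t = ⟨ x , cond (χ (matrix-Δ₁ R-Σ₁) (t ∷ i ∷ x ∷ pred y ∷ [])) y 0 ⟩

        enum : ℕ → ℕ → ℕ
        enum i u = body i (π₁ u) (π₁ (π₂ u)) (π₂ (π₂ u))

        enum-⟨⟩ : ∀ i x y t → enum i ⟨ x , ⟨ y , t ⟩ ⟩ ≡ body i x y t
        enum-⟨⟩ i x y t
          rewrite π₁-⟨⟩ x ⟨ y , t ⟩ | π₂-⟨⟩ x ⟨ y , t ⟩ | π₁-⟨⟩ y t | π₂-⟨⟩ y t = refl

        enum-computable : Computableⁿ 2 enum
        enum-computable = computable₂ (ap₂ computable x-comp (cond-computable
          (χ-computable (matrix-Δ₁ R-Σ₁) ∘ᶜ
            ap₁ π₂-computable (ap₁ π₂-computable (var 1F)) ∷ᶜ var 0F ∷ᶜ x-comp ∷ᶜ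
            ap₁ pred-computable y-comp ∷ᶜ []ᶜ)
          y-comp (const 0)))
          where
          x-comp : Computable {2} (λ v → π₁ (lookup v 1F))
          x-comp = ap₁ π₁-computable (var 1F)

          y-comp : Computable {2} (λ v → π₁ (π₂ (lookup v 1F)))
          y-comp = ap₁ π₁-computable (ap₁ π₂-computable (var 1F))

        module _ {i q} (q-rep : Represents R i q) where

          body⊆ : ∀ x y t → extendedGraph P q (body i x y t)
          -- For `y = 0` both outcomes of the check produce 0, although the check itself is made for
          -- the value `pred 0`.
          body⊆ x zero    t = inj₁ (untuple n x ,
            cong₂ ⟨_,_⟩ (sym (tuple-untuple n x)) (cond-idem (χ (matrix-Δ₁ R-Σ₁) _)))
          body⊆ x (suc z) t with χ (matrix-Δ₁ R-Σ₁) (t ∷ i ∷ x ∷ z ∷ []) in eq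
          ... | suc _ = inj₁ (untuple n x , cong ⟨_, 0 ⟩ (sym (tuple-untuple n x)))
          ... | zero  = inj₂ (untuple n x , z ,
            proj₂ (q-rep x z) (∃⇒ R-Σ₁ _ t (sound (matrix-Δ₁ R-Σ₁) _ eq)) ,
            cong ⟨_, suc z ⟩ (sym (tuple-untuple n x)))

          ⊆enum : ∀ {w} → extendedGraph P q w → Range (enum i) w
          ⊆enum (inj₁ (ys , refl)) = ⟨ tuple ys , ⟨ 0 , 0 ⟩ ⟩ , sym (trans
            (enum-⟨⟩ i (tuple ys) 0 0) (cong ⟨ tuple ys ,_⟩ (cond-idem (χ (matrix-Δ₁ R-Σ₁) _))))
          ⊆enum (inj₂ (xs , z , qxs≡z , refl))
            with t , m ← ⇒∃ R-Σ₁ (i ∷ tuple xs ∷ z ∷ [])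
                           (proj₁ (q-rep (tuple xs) z) (trans (cong q (untuple-tuple xs)) qxs≡z)) =
            ⟨ tuple xs , ⟨ suc z , t ⟩ ⟩ , sym (trans (enum-⟨⟩ i (tuple xs) (suc z) t)
              (cong (λ c → ⟨ tuple xs , cond c (suc z) 0 ⟩) (complete (matrix-Δ₁ R-Σ₁) _ m)))

      abstract
        -- The form in which (QGN II) is applied: a semidecidable family has computable indices
        -- wherever its sections are graphs of members of `𝒮 A n`. The enumeration `enum` turns the
        -- sections into extended graphs.
        uniformIndex : ∃ λ v → Computableⁿ 1 v ×
                         (∀ i (r : Carrier) → Represents R i (proj₁ r) → r ≈ θ[ v i ])
        uniformIndex with v , v-computable , v-correct ← QGN-II enum enum-computable =
          v , v-computable , λ i r r-rep →
            v-correct i r ((λ { (u , refl) → body⊆ r-rep _ _ _ }) , ⊆enum r-rep)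

  -- A total function with a semidecidable graph is computable, and the members with finite domain
  -- are common to both classes.
  computablePart : ∀ {A n} .{{_ : NonZero n}} (s : Setoid.Carrier (Ŝ A n)) →
    Σ₁ {2} (λ v → proj₁ s (untuple n (lookup v 0F)) ≡ just (lookup v 1F)) →
    ∃ λ (r : Setoid.Carrier (𝒮 A n)) → proj₁ r ≡ proj₁ s
  computablePart (q , inj₂ q∈Anf)           _    = (q , inj₂ q∈Anf) , refl
  computablePart {n = n} (q , inj₁ (f , q≗f)) q-Σ₁ = (q , inj₁ (f , f-computable , q≗f)) , refl
    where
    q∘untuple∘tuple : ∀ xs → q (untuple n (tuple xs)) ≡ just (f xs)
    q∘untuple∘tuple xs = trans (cong q (untuple-tuple xs)) (q≗f xs)

    f-computable : Computable f
    f-computable = Σ₁-graph⇒computable (Σ₁-map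
      (λ { (z ∷ xs) eq → just-injective (trans (sym eq) (q∘untuple∘tuple xs)) })
      (λ { (z ∷ xs) refl → q∘untuple∘tuple xs })
      (Σ₁-sub q-Σ₁ ((tuple-computable n ∘ᶜ tailᶜ idᶜ) ∷ᶜ var 0F ∷ᶜ []ᶜ)))

  -- `inclusion` reduces only after its argument has been split, so for a variable `r` this equation
  -- has to be applied explicitly.
  inclusion-values : ∀ {A n} (r : Setoid.Carrier (𝒮 A n)) → proj₁ (inclusion {A} {n} r) ≡ proj₁ r
  inclusion-values (_ , inj₁ _) = refl
  inclusion-values (_ , inj₂ _) = refl

  module _ (S : SequenceCoding) {A : Pred ℕ 0ℓ} {n m : ℕ} .{{_ : NonZero n}} .{{_ : NonZero m}}
           (θ : Numbering (𝒮 A n)) (θ-quasiGödel : IsQuasiGödel P θ)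
           (θ′ : Numbering (𝒮 A m)) (θ′-quasiGödel : IsQuasiGödel P θ′) where
    open SequenceCoding S using (decode)
    private
      module D = QuasiGödel θ θ-quasiGödel
      module E = QuasiGödel θ′ θ′-quasiGödel

    -- From computable operators to Markov-computable ones

    computable⇒markovComputable :
      (Ĝ : Ŝ A n ⟶ₛ Ŝ A m) → ComputableOperator P S Ĝ →
      ∃ λ (G : 𝒮 A n ⟶ₛ 𝒮 A m) → G IsRestrictionOf Ĝ × MarkovComputable θ θ′ G
    computable⇒markovComputable Ĝ (C , C-ce , Ĝ-graph) = G , G-restricts , G-markov
      where
      open Setoid (𝒮 A n) using (Carrier; _≈_)

      Ĝ[_] : Carrier → PFun m
      Ĝ[ r ] = proj₁ (Func.to Ĝ (inclusion {A} {n} r))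

      Ĝ-cong : ∀ r s → r ≈ s → Ĝ[ r ] ≗ Ĝ[ s ]
      Ĝ-cong r s r≈s = Func.cong Ĝ
        (subst₂ _≗_ (sym (inclusion-values {A} {n} r)) (sym (inclusion-values {A} {n} s)) r≈s)

      -- The defining condition of a computable operator at the argument `θ i`, with graph
      -- membership expressed on codes so that `value-Σ₁` applies.
      R : Vec ℕ 3 → Set
      R v = ∃ λ a → C ⟨ ⟨ lookup v 1F , lookup v 2F ⟩ , a ⟩ ×
                    Listᴬ.All (_codesValueOf proj₁ D.θ[ lookup v 0F ]) (decode a)

      R-Σ₁ : Σ₁ R
      R-Σ₁ = Σ₁-∃ (Σ₁-×
        (Σ₁-sub (CE⇒Σ₁ C-ce) (ap₂ computable (ap₂ computable (var 2F) (var 3F)) (var 0F) ∷ᶜ []ᶜ))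
        (Σ₁-All S (Σ₁-sub D.value-Σ₁
          (var 2F ∷ᶜ ap₁ π₁-computable (var 0F) ∷ᶜ ap₁ π₂-computable (var 0F) ∷ᶜ []ᶜ)) (var 0F)))

      R-represents : ∀ i → E.Represents R i Ĝ[ D.θ[ i ] ]
      R-represents i x z = value⇒R , R⇒value
        where
        value⇒R : Ĝ[ D.θ[ i ] ] (untuple m x) ≡ just z → R (i ∷ x ∷ z ∷ [])
        value⇒R eq with _ , _ , w≡ , a , c , all ← proj₁ (Ĝ-graph (inclusion {A} {n} D.θ[ i ])) (value⇒graph eq) =
          a , subst (λ w → C ⟨ w , a ⟩) (sym w≡) c ,
          Listᴬ.map (λ {w} → subst (w codesValueOf_) (inclusion-values {A} {n} D.θ[ i ]) ∘ graph⇒codesValue) all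

        R⇒value : R (i ∷ x ∷ z ∷ []) → Ĝ[ D.θ[ i ] ] (untuple m x) ≡ just z
        R⇒value (a , c , all) = graph⇒value (proj₂ (Ĝ-graph (inclusion {A} {n} D.θ[ i ]))
          (untuple m x , z , w≡ , a , subst (λ w → C ⟨ w , a ⟩) w≡ c ,
           Listᴬ.map (λ {w} → codesValue⇒graph ∘ subst (w codesValueOf_) (sym (inclusion-values {A} {n} D.θ[ i ])))
                     all))
          where
          w≡ : ⟨ x , z ⟩ ≡ ⟨ tuple (untuple m x) , z ⟩
          w≡ = cong ⟨_, z ⟩ (sym (tuple-untuple m x))

      abstract
        -- If `i` is an index of `r`, the section of `R` at `i` semidecides the values of `Ĝ[ r ]`;
        -- hence this function is already a member of `𝒮 A m`.
        G-part : ∀ r → ∃ λ (s : Setoid.Carrier (𝒮 A m)) → proj₁ s ≡ Ĝ[ r ]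
        G-part r with i , θi≈r ← D.index r =
          computablePart (Func.to Ĝ (inclusion {A} {n} r)) (Σ₁-map
            (λ { (x ∷ z ∷ []) ρ → trans (sym (Ĝ-cong D.θ[ i ] r θi≈r _)) (proj₂ (R-represents i x z) ρ) })
            (λ { (x ∷ z ∷ []) eq → proj₁ (R-represents i x z) (trans (Ĝ-cong D.θ[ i ] r θi≈r _) eq) })
            (Σ₁-sub R-Σ₁ (const i ∷ᶜ var 0F ∷ᶜ var 1F ∷ᶜ []ᶜ)))

      G-values : ∀ r xs → proj₁ (proj₁ (G-part r)) xs ≡ Ĝ[ r ] xs
      G-values r xs = cong (λ q → q xs) (proj₂ (G-part r))

      G : 𝒮 A n ⟶ₛ 𝒮 A m
      G = record
        { to   = proj₁ ∘ G-part
        ; cong = λ {r} {s} r≈s xs → trans (G-values r xs) (trans (Ĝ-cong r s r≈s xs) (sym (G-values s xs)))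
        }

      G-restricts : G IsRestrictionOf Ĝ
      G-restricts r xs =
        trans (cong (λ q → q xs) (inclusion-values {A} {m} (proj₁ (G-part r)))) (G-values r xs)

      G-markov : MarkovComputable θ θ′ G
      G-markov = let g , g-computable , g-correct = E.uniformIndex R-Σ₁ in
        g , g-computable , λ i → g-correct i (proj₁ (G-part D.θ[ i ]))
          (subst (E.Represents R i) (sym (proj₂ (G-part D.θ[ i ]))) (R-represents i))

    -- From Markov-computable operators to computable ones

    module Extension (em : ExcludedMiddle 0ℓ) (A-infinite : Infinite A) (A-ce : CE A)
                     (θ₁ : Numbering (𝒮 A 1)) (θ₁-quasiGödel : IsQuasiGödel P θ₁)
                     (G : 𝒮 A n ⟶ₛ 𝒮 A m) (G-markov : MarkovComputable θ θ′ G) where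
      private module U = QuasiGödel θ₁ θ₁-quasiGödel
      open Setoid (𝒮 A n) using (Carrier; _≈_)

      G[_] : Carrier → PFun m
      G[ r ] = proj₁ (Func.to G r)

      ∅ : ∀ {l} → Setoid.Carrier (𝒮 A l)
      ∅ = (λ _ → nothing) , inj₂ (inj₁ λ { _ (_ , ()) })

      -- Since the cube of side 0 is empty, it stands for the empty domain.
      A₀ : Pred ℕ 0ℓ
      A₀ b = b ≡ 0 ⊎ A b

      abstract
        -- The member 0 of `A₀` is the default value of the enumeration.
        A₀-enumeration : ∃ λ α → Computableⁿ 1 α × A₀ ≐ Range α
        A₀-enumeration = Σ₁⇒range (Σ₁-⊎ (Δ₁⇒Σ₁ (Δ₁-≡ (var 0F) (const 0))) (CE⇒Σ₁ A-ce)) (inj₁ refl)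

      α : ℕ → ℕ
      α = proj₁ A₀-enumeration

      α-computable : Computableⁿ 1 α
      α-computable = proj₁ (proj₂ A₀-enumeration)

      A₀⇒α : ∀ {b} → A₀ b → ∃ λ s → b ≡ α s
      A₀⇒α = proj₁ (proj₂ (proj₂ A₀-enumeration))

      A₀-α : ∀ s → A₀ (α s)
      A₀-α s = proj₂ (proj₂ (proj₂ A₀-enumeration)) (s , refl)

      -- Otherwise the list of the numbers up to `N` would contain all of `A`.
      A₀-unbounded : ∀ N → ∃ λ b → A₀ b × N < b
      A₀-unbounded N with em {∃ λ b → A₀ b × N < b}
      ... | yes p = p
      ... | no ¬p = contradiction
        (List.upTo (suc N) , λ {a} a∈A → ∈-upTo⁺ (≰⇒> λ N<a → ¬p (a , inj₂ a∈A , N<a))) A-infinite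

      HasDomain : ∀ {l} → PFun l → ℕ → Set
      HasDomain q b = A₀ b × dom q ≐ All (_< b)

      -- In positive arity the cube of side 0 has no points, so the side 0 describes the empty
      -- domain.
      anf⇒hasDomain : ∀ {l} .{{_ : NonZero l}} {q : PFun l} → Anf A l q → ∃ (HasDomain q)
      anf⇒hasDomain (inj₁ q-empty) =
        0 , inj₁ refl , (λ {xs} d → contradiction d (q-empty xs)) , λ { {_ ∷ _} (() ∷ _) }
      anf⇒hasDomain (inj₂ (a , a∈A , dom-q)) = a , inj₂ a∈A , dom-q

      hasDomain⇒anf : ∀ {l} .{{_ : NonZero l}} {q : PFun l} {b} → HasDomain q b → Anf A l q
      hasDomain⇒anf (inj₁ refl , dom⊆ , _) = inj₁ λ { xs@(_ ∷ _) d → contradiction (All.head (dom⊆ {xs} d)) λ () }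
      hasDomain⇒anf (inj₂ b∈A , dom-q)     = inj₂ (_ , b∈A , dom-q)

      infix 4 _⊑_
      _⊑_ : PFun n → PFun n → Set
      p ⊑ q = ∀ {xs z} → p xs ≡ just z → q xs ≡ just z

      restrict : PFun n → ℕ → PFun n
      restrict q b xs = if does (All.all? (_<? b) xs) then q xs else nothing

      restrict⇒ : ∀ q b {xs z} → restrict q b xs ≡ just z → All (_< b) xs × q xs ≡ just z
      restrict⇒ q b {xs} eq with All.all? (_<? b) xs
      restrict⇒ q b eq | yes xs<b = xs<b , eq
      restrict⇒ q b () | no  _

      ⇒restrict : ∀ q b {xs z} → All (_< b) xs → q xs ≡ just z → restrict q b xs ≡ just z
      ⇒restrict q b {xs} xs<b eq with All.all? (_<? b) xs
      ... | yes _    = eq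
      ... | no  xs≮b = contradiction xs<b xs≮b

      restrict-hasDomain : ∀ q {b} → A₀ b → (∀ {xs} → All (_< b) xs → xs ∈ dom q) → HasDomain (restrict q b) b
      restrict-hasDomain q {b} b∈A₀ cube⊆dom =
        b∈A₀ , (λ (z , eq) → proj₁ (restrict⇒ q b eq)) ,
        λ xs<b → let z , eq = cube⊆dom xs<b in z , ⇒restrict q b xs<b eq

      -- A c.e. set with non-c.e. complement

      K : ℕ → Set
      K i = ∃ λ x → proj₁ U.θ[ i ] (x ∷ []) ≡ just i

      abstract
        K-Σ₁ : Σ₁ {1} (λ v → K (lookup v 0F))
        K-Σ₁ = Σ₁-∃ (Σ₁-sub U.value-Σ₁ (var 1F ∷ᶜ var 0F ∷ᶜ var 1F ∷ᶜ []ᶜ))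

      -- θ₁ numbers all c.e. sets as the ranges of its members, and K i says
      -- that i belongs to the i-th of them.
      K-complement-not-Σ₁ : ¬ Σ₁ {1} (λ v → ¬ K (lookup v 0F))
      K-complement-not-Σ₁ ¬K-Σ₁
        -- An index of the empty function lies outside `K`, so it can be the default value when the
        -- complement is listed as a range.
        with i∅ , θi∅≈∅ ← U.index ∅
        with f , f-computable , ¬K⊆range , range⊆¬K ←
               Σ₁⇒range {c = i∅} ¬K-Σ₁ (λ (x , eq) → contradiction (trans (sym (θi∅≈∅ (x ∷ []))) eq) λ ())
        -- The diagonal step: the listing function `f` is total and computable, and its index `j`
        -- would belong to `K` exactly if it does not.
        with j , θj≈f ← U.index (just ∘ (f $ⁿ_) , inj₁ ((f $ⁿ_) , f-computable , λ _ → refl)) =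
        ¬Kj (let t , eq = ¬K⊆range ¬Kj in t , trans (θj≈f (t ∷ [])) (cong just (sym eq)))
        where
        ¬Kj : ¬ K j
        ¬Kj (x , eq) = range⊆¬K (x , sym (just-injective (trans (sym (θj≈f (x ∷ []))) eq))) (x , eq)

      -- A family that equals p off K cannot have G take different values on
      -- all members over K: otherwise the complement of K would be c.e.
      spill : ∀ {R} → Σ₁ R → (p : Carrier) → (∀ i → ¬ K i → D.Represents R i (proj₁ p)) →
              ∀ {ys z} → G[ p ] ys ≡ just z →
              ∃ λ i → K i × (∀ q → D.Represents R i (proj₁ q) → G[ q ] ys ≡ just z)
      spill {R} R-Σ₁ p p-rep {ys} {z} Gp≡z = from-em em
        where
        v g : ℕ → ℕ
        v = proj₁ (D.uniformIndex R-Σ₁)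
        g = proj₁ G-markov

        T : ℕ → Set
        T i = proj₁ E.θ[ g (v i) ] (untuple m (tuple ys)) ≡ just z

        T-Σ₁ : Σ₁ {1} (λ u → T (lookup u 0F))
        T-Σ₁ = Σ₁-sub E.value-Σ₁
          (ap₁ (proj₁ (proj₂ G-markov)) (ap₁ (proj₁ (proj₂ (D.uniformIndex R-Σ₁))) (var 0F)) ∷ᶜ
           const (tuple ys) ∷ᶜ const z ∷ᶜ []ᶜ)

        G≗ : ∀ i q → D.Represents R i (proj₁ q) → G[ q ] ys ≡ proj₁ E.θ[ g (v i) ] (untuple m (tuple ys))
        G≗ i q q-rep = trans
          (trans (Func.cong G (proj₂ (proj₂ (D.uniformIndex R-Σ₁)) i q q-rep) ys) (proj₂ (proj₂ G-markov) (v i) ys))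
          (cong (proj₁ E.θ[ g (v i) ]) (sym (untuple-tuple ys)))

        from-em : Dec (∃ λ i → K i × T i) → _
        from-em (yes (i , Ki , Ti)) = i , Ki , λ q q-rep → trans (G≗ i q q-rep) Ti
        -- In this case `T` holds exactly off `K`, so it would semidecide the complement.
        from-em (no  ¬KT)           = contradiction
          (Σ₁-map (λ { (i ∷ []) Ti Ki → ¬KT (i , Ki , Ti) })
                  (λ { (i ∷ []) ¬Ki → trans (sym (G≗ i p (p-rep i ¬Ki))) Gp≡z })
                  T-Σ₁)
          K-complement-not-Σ₁

      -- Monotonicity and compactness

      G-monotone : (p r : Carrier) → proj₁ p ⊑ proj₁ r → ∀ {ys z} → G[ p ] ys ≡ just z → G[ r ] ys ≡ just z
      G-monotone p r p⊑r Gp≡z = let i , Ki , Gq≡z = spill R-Σ₁ p p-rep Gp≡z in Gq≡z r (r-rep i Ki)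
        where
        ip ir : ℕ
        ip = proj₁ (D.index p)
        ir = proj₁ (D.index r)

        -- Off `K` the section is the graph of `p`; on `K` it is the union of both graphs, which is
        -- that of `r` because `p ⊑ r`.
        R : Vec ℕ 3 → Set
        R v = proj₁ D.θ[ ip ] (untuple n (lookup v 1F)) ≡ just (lookup v 2F) ⊎
              K (lookup v 0F) × proj₁ D.θ[ ir ] (untuple n (lookup v 1F)) ≡ just (lookup v 2F)

        R-Σ₁ : Σ₁ R
        R-Σ₁ = Σ₁-⊎ (Σ₁-sub D.value-Σ₁ (const ip ∷ᶜ var 1F ∷ᶜ var 2F ∷ᶜ []ᶜ))
          (Σ₁-× (Σ₁-sub K-Σ₁ (var 0F ∷ᶜ []ᶜ)) (Σ₁-sub D.value-Σ₁ (const ir ∷ᶜ var 1F ∷ᶜ var 2F ∷ᶜ []ᶜ)))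

        θip≈p : D.θ[ ip ] ≈ p
        θip≈p = proj₂ (D.index p)

        θir≈r : D.θ[ ir ] ≈ r
        θir≈r = proj₂ (D.index r)

        p-rep : ∀ i → ¬ K i → D.Represents R i (proj₁ p)
        p-rep i ¬Ki x z = inj₁ ∘ trans (θip≈p _) ,
          [ trans (sym (θip≈p _)) , (λ (Ki , _) → contradiction Ki ¬Ki) ]′

        r-rep : ∀ i → K i → D.Represents R i (proj₁ r)
        r-rep i Ki x z = (λ eq → inj₂ (Ki , trans (θir≈r _) eq)) ,
          [ p⊑r ∘ trans (sym (θip≈p _)) , (λ (_ , eq) → trans (sym (θir≈r _)) eq) ]′

      -- Meaningful for arbitrary `q`, computable or not, since `G` is applied only to finite parts
      -- of `q`.
      Approx : PFun n → Vec ℕ m → ℕ → Set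
      Approx q ys z = ∃₂ λ (p : Carrier) b → HasDomain (proj₁ p) b × proj₁ p ⊑ q × G[ p ] ys ≡ just z

      -- A member with finite domain is a finite part of itself. For a total one, `spill` is applied
      -- to a family that is `r` off `K` and a finite part of `r` on `K`.
      G-compact : (r : Carrier) → ∀ {ys z} → G[ r ] ys ≡ just z → Approx (proj₁ r) ys z
      G-compact r@(q , inj₂ q∈Anf) Gr≡z = let b , q-dom = anf⇒hasDomain q∈Anf in r , b , q-dom , id , Gr≡z
      G-compact r@(q , inj₁ (f , _ , q≗f)) {ys} {z} Gr≡z =
        let i , Ki , Gp≡z = spill R-Σ₁ r r-rep Gr≡z
            p , b , p-dom , p⊑q , p-rep = truncation i Ki
        in p , b , p-dom , p⊑q , Gp≡z p p-rep
        where
        ir : ℕ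
        ir = proj₁ (D.index r)

        θir≈r : D.θ[ ir ] ≈ r
        θir≈r = proj₂ (D.index r)

        EnteredAt : ℕ → ℕ → Set
        EnteredAt i t = Σ₁.matrix K-Σ₁ (t ∷ i ∷ [])

        -- Off K this is r; once i has entered K, no further cubes are added.
        R : Vec ℕ 3 → Set
        R v = ∃ λ s → All (_< α s) (untuple n (lookup v 1F)) ×
                      (∀ t → t < s → ¬ EnteredAt (lookup v 0F) t) ×
                      proj₁ D.θ[ ir ] (untuple n (lookup v 1F)) ≡ just (lookup v 2F)

        R-Σ₁ : Σ₁ R
        R-Σ₁ = Σ₁-∃ (Σ₁-×
          (Δ₁⇒Σ₁ (Δ₁-cube n (var 2F) (ap₁ α-computable (var 0F))))
          (Σ₁-×
            (Δ₁⇒Σ₁ (Δ₁-∀< (Δ₁-¬ (Δ₁-sub (Σ₁.matrix-Δ₁ K-Σ₁) (var 0F ∷ᶜ var 2F ∷ᶜ []ᶜ))) (var 0F)))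
            (Σ₁-sub D.value-Σ₁ (const ir ∷ᶜ var 2F ∷ᶜ var 3F ∷ᶜ []ᶜ))))

        r-rep : ∀ i → ¬ K i → D.Represents R i q
        r-rep i ¬Ki x z = value⇒R , λ (_ , _ , _ , eq) → trans (sym (θir≈r _)) eq
          where
          value⇒R : q (untuple n x) ≡ just z → R (i ∷ x ∷ z ∷ [])
          value⇒R eq with _ , b∈A₀ , x<b ← A₀-unbounded x
                     with s , refl ← A₀⇒α b∈A₀ =
            s , All.map (λ y≤ → ≤-<-trans (≤-trans y≤ (≤-reflexive (tuple-untuple n x))) x<b)
                        (entries≤tuple (untuple n x)) ,
            (λ t _ entered → ¬Ki (Σ₁.∃⇒ K-Σ₁ (i ∷ []) t entered)) , trans (θir≈r _) eq

        truncation : ∀ i → K i → ∃₂ λ (p : Carrier) b →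
                     HasDomain (proj₁ p) b × proj₁ p ⊑ q × D.Represents R i (proj₁ p)
        truncation i Ki
          with t₀ , entered , least ← leastWitness (λ t → decide (Σ₁.matrix-Δ₁ K-Σ₁) (t ∷ i ∷ []))
                                                   (Σ₁.⇒∃ K-Σ₁ (i ∷ []) Ki)
          with s₀ , s₀≤t₀ , max ← argmax α t₀ =
          (restrict q (α s₀) , inj₂ (hasDomain⇒anf p-dom)) , α s₀ , p-dom ,
          (λ eq → proj₂ (restrict⇒ q (α s₀) eq)) , p-rep
          where
          p-dom : HasDomain (restrict q (α s₀)) (α s₀)
          p-dom = restrict-hasDomain q (A₀-α s₀) (λ {xs} _ → f xs , q≗f xs)

          p-rep : D.Represents R i (restrict q (α s₀))
          p-rep x z =
            (λ eq → let x<b , qx≡z = restrict⇒ q (α s₀) eq in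
              s₀ , x<b , (λ t t<s₀ → least t (<-≤-trans t<s₀ s₀≤t₀)) , trans (θir≈r _) qx≡z) ,
            (λ (s , x<αs , ¬entered , eq) →
              ⇒restrict q (α s₀)
                (All.map (λ y< → <-≤-trans y< (max (≮⇒≥ λ t₀<s → ¬entered t₀ t₀<s entered))) x<αs)
                (trans (sym (θir≈r _)) eq))

      -- The extension

      -- Both are parts of the same `q`, so they agree wherever both are defined, and the smaller
      -- cube lies in the larger.
      nested : ∀ {q} (p p′ : Carrier) {b b′} → HasDomain (proj₁ p) b → HasDomain (proj₁ p′) b′ →
               proj₁ p ⊑ q → proj₁ p′ ⊑ q → b ≤ b′ → proj₁ p ⊑ proj₁ p′
      nested p p′ (_ , p⊆cube , _) (_ , _ , cube⊆p′) p⊑q p′⊑q b≤b′ px≡z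
        with z′ , p′x≡z′ ← cube⊆p′ (All.map (λ x<b → <-≤-trans x<b b≤b′) (p⊆cube (_ , px≡z))) =
        trans p′x≡z′ (trans (sym (p′⊑q p′x≡z′)) (p⊑q px≡z))

      -- One of the two finite parts extends the other, and `G-monotone` carries the value over.
      Approx-functional : ∀ {q ys z z′} → Approx q ys z → Approx q ys z′ → z ≡ z′
      Approx-functional (p , _ , p-dom , p⊑q , Gp≡z) (p′ , _ , p′-dom , p′⊑q , Gp′≡z′) =
        just-injective ([ (λ b≤b′ → trans (sym (G-monotone p p′ (nested p p′ p-dom p′-dom p⊑q p′⊑q b≤b′) Gp≡z)) Gp′≡z′)
                        , (λ b′≤b → trans (sym Gp≡z) (G-monotone p′ p (nested p′ p p′-dom p-dom p′⊑q p⊑q b′≤b) Gp′≡z′))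
                        ]′ (≤-total _ _))

      Approx-mono : ∀ {q q′ ys z} → q ⊑ q′ → Approx q ys z → Approx q′ ys z
      Approx-mono q⊑q′ (p , b , p-dom , p⊑q , Gp≡z) = p , b , p-dom , q⊑q′ ∘ p⊑q , Gp≡z

      limit : PFun n → PFun m
      limit q ys with em {∃ (Approx q ys)}
      ... | yes (z , _) = just z
      ... | no  _       = nothing

      limit⇒Approx : ∀ q {ys z} → limit q ys ≡ just z → Approx q ys z
      limit⇒Approx q {ys} eq with em {∃ (Approx q ys)}
      limit⇒Approx q refl | yes (_ , a) = a
      limit⇒Approx q ()   | no  _

      Approx⇒limit : ∀ q {ys z} → Approx q ys z → limit q ys ≡ just z
      Approx⇒limit q {ys} a with em {∃ (Approx q ys)}
      ... | yes (_ , a′) = cong just (Approx-functional a′ a)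
      ... | no  ¬a       = contradiction (_ , a) ¬a

      limit-member : ∀ q → (ℱ m ∪ Anf A m) (limit q)
      limit-member q with em {∃ λ ys → ¬ ∃ (Approx q ys)}
      ... | no total = inj₁ (proj₁ ∘ value , λ ys → Approx⇒limit q (proj₂ (value ys)))
        where
        value : ∀ ys → ∃ (Approx q ys)
        value ys = decidable-stable em λ ¬a → total (ys , ¬a)
      -- All values G p with p ⊑ q are undefined at ys₀, so their domains are
      -- cubes of bounded side; the largest of them is the domain of the limit.
      ... | yes (ys₀ , undefined) = inj₂ (hasDomain⇒anf (b∈A₀ , limit⊆cube , cube⊆limit))
        where
        T : ℕ → Set
        T b = ∃₂ λ (p : Carrier) c → HasDomain (proj₁ p) c × proj₁ p ⊑ q × HasDomain G[ p ] b

        T-all : (p : Carrier) → ∀ {c} → HasDomain (proj₁ p) c → proj₁ p ⊑ q → ∃ λ b → T b × HasDomain G[ p ] b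
        T-all p {c} p-dom p⊑q with proj₂ (Func.to G p)
        -- A total `G[ p ]` would have a value at `ys₀`.
        ... | inj₁ (f , _ , Gp≗f) = ⊥-elim (undefined (f ys₀ , p , c , p-dom , p⊑q , Gp≗f ys₀))
        ... | inj₂ Gp∈Anf = let b , Gp-dom = anf⇒hasDomain Gp∈Anf in b , (p , c , p-dom , p⊑q , Gp-dom) , Gp-dom

        -- A cube of side greater than the code of `ys₀` would contain `ys₀`.
        T-bounded : ∀ {b} → T b → b ≤ tuple ys₀
        T-bounded (p , c , p-dom , p⊑q , _ , _ , cube⊆Gp) = ≮⇒≥ λ ys₀<b →
          let z , Gp≡z = cube⊆Gp (All.map (λ y≤ → ≤-<-trans y≤ ys₀<b) (entries≤tuple ys₀)) in
          undefined (z , p , c , p-dom , p⊑q , Gp≡z)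

        -- The empty function is a finite part of every `q`.
        T-nonempty : ∃ T
        T-nonempty = let b , t , _ = T-all ∅ ∅-dom (λ ()) in b , t
          where
          ∅-dom : HasDomain {n} (λ _ → nothing) 0
          ∅-dom = proj₂ (anf⇒hasDomain (inj₁ λ { _ (_ , ()) }))

        max-b : ∃ λ b → T b × (∀ {c} → T c → c ≤ b)
        max-b = maximum em T-nonempty (tuple ys₀) T-bounded

        b : ℕ
        b = proj₁ max-b

        T-b : T b
        T-b = proj₁ (proj₂ max-b)

        b∈A₀ : A₀ b
        b∈A₀ = let _ , _ , _ , _ , b∈A₀ , _ = T-b in b∈A₀

        limit⊆cube : ∀ {ys} → ys ∈ dom (limit q) → All (_< b) ys
        limit⊆cube (z , eq)
          with p , _ , p-dom , p⊑q , Gp≡z ← limit⇒Approx q eq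
          with _ , t , _ , Gp⊆cube , _ ← T-all p p-dom p⊑q =
          All.map (λ y<c → <-≤-trans y<c (proj₂ (proj₂ max-b) t)) (Gp⊆cube (z , Gp≡z))

        cube⊆limit : ∀ {ys} → All (_< b) ys → ys ∈ dom (limit q)
        cube⊆limit ys<b with p , c , p-dom , p⊑q , _ , _ , cube⊆Gp ← T-b =
          let z , Gp≡z = cube⊆Gp ys<b in z , Approx⇒limit q (p , c , p-dom , p⊑q , Gp≡z)

      Ĝ : Ŝ A n ⟶ₛ Ŝ A m
      Ĝ = record
        { to   = λ (q , _) → limit q , limit-member q
        ; cong = λ {(q , _)} {(q′ , _)} q≗q′ ys → maybe-ext
            (Approx⇒limit q′ ∘ Approx-mono (λ {xs} → trans (sym (q≗q′ xs))) ∘ limit⇒Approx q)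
            (Approx⇒limit q ∘ Approx-mono (λ {xs} → trans (q≗q′ xs)) ∘ limit⇒Approx q′)
        }

      -- Compactness shows that every value of `G` is one of the limit, and monotonicity gives the
      -- converse.
      G-restricts-Ĝ : G IsRestrictionOf Ĝ
      G-restricts-Ĝ r ys = trans (cong (λ q → q ys) (inclusion-values {A} {m} (Func.to G r)))
        (trans (maybe-ext
          (Approx⇒limit (proj₁ r) ∘ G-compact r)
          (λ eq → let p , _ , _ , p⊑r , Gp≡z = limit⇒Approx (proj₁ r) eq in G-monotone p r p⊑r Gp≡z))
        (cong (λ q → limit q ys) (sym (inclusion-values {A} {n} r))))

      -- Computability of the extension

      cubeList : ∀ l → ℕ → List (Vec ℕ l)
      cubeList zero    b = [] ∷ []
      cubeList (suc l) b = List.cartesianProductWith _∷_ (List.upTo b) (cubeList l b)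

      cubeList-complete : ∀ {l b} {xs : Vec ℕ l} → All (_< b) xs → xs ∈ᴸ cubeList l b
      cubeList-complete []           = here refl
      cubeList-complete (x<b ∷ xs<b) = ∈-cartesianProductWith⁺ _∷_ (∈-upTo⁺ x<b) (cubeList-complete xs<b)

      -- Provides the finite sequence by which a finite part will be accepted; points at which `q`
      -- is undefined are skipped.
      graphList : (q : PFun n) (xss : List (Vec ℕ n)) → ∃ λ ws → Listᴬ.All (graph P q) ws ×
                  (∀ {xs} → xs ∈ᴸ xss → xs ∈ dom q → Any (λ w → π₁ w ≡ tuple xs) ws)
      graphList q []         = [] , [] , λ ()
      graphList q (xs ∷ xss) with graphList q xss | q xs in eq
      ... | ws , ws⊆q , covers | nothing = ws , ws⊆q , λ
        { (here refl) (_ , eq′) → contradiction (trans (sym eq) eq′) λ () ; (there xs∈) → covers xs∈ }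
      ... | ws , ws⊆q , covers | just z  = ⟨ tuple xs , z ⟩ ∷ ws , (xs , z , eq , refl) ∷ ws⊆q , λ
        { (here refl) _ → here (π₁-⟨⟩ _ z) ; (there xs∈) d → there (covers xs∈ d) }

      graphCode : (q : PFun n) (xss : List (Vec ℕ n)) → ∃ λ a → Listᴬ.All (graph P q) (decode a) ×
                  (∀ {xs} → xs ∈ᴸ xss → xs ∈ dom q → Any (λ w → π₁ w ≡ tuple xs) (decode a))
      graphCode q xss with ws , ws-spec ← graphList q xss
                      with a , decode-a ← proj₂ (SequenceCoding.bijective S) ws
                      with refl ← decode-a refl = a , ws-spec

      -- The parameter codes a pair of `j` and `s`, and the section is the graph of `θ j` restricted
      -- to the cube of side `α s`. Hence indices of such restrictions can be computed.
      RestrictionValue : Vec ℕ 3 → Set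
      RestrictionValue v = All (_< α (π₂ (lookup v 0F))) (untuple n (lookup v 1F)) ×
        proj₁ D.θ[ π₁ (lookup v 0F) ] (untuple n (lookup v 1F)) ≡ just (lookup v 2F)

      abstract
        RestrictionValue-Σ₁ : Σ₁ RestrictionValue
        RestrictionValue-Σ₁ = Σ₁-×
          (Δ₁⇒Σ₁ (Δ₁-cube n (var 1F) (ap₁ α-computable (ap₁ π₂-computable (var 0F)))))
          (Σ₁-sub D.value-Σ₁ (ap₁ π₁-computable (var 0F) ∷ᶜ var 1F ∷ᶜ var 2F ∷ᶜ []ᶜ))

      g v : ℕ → ℕ
      g = proj₁ G-markov
      v = proj₁ (D.uniformIndex RestrictionValue-Σ₁)

      v-restrict : ∀ j s (p : Carrier) → proj₁ p ≗ restrict (proj₁ D.θ[ j ]) (α s) → p ≈ D.θ[ v ⟨ j , s ⟩ ]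
      v-restrict j s p p≗ = proj₂ (proj₂ (D.uniformIndex RestrictionValue-Σ₁)) ⟨ j , s ⟩ p p-rep
        where
        p-rep : D.Represents RestrictionValue ⟨ j , s ⟩ (proj₁ p)
        p-rep x z rewrite π₁-⟨⟩ j s | π₂-⟨⟩ j s | p≗ (untuple n x) =
          restrict⇒ (proj₁ D.θ[ j ]) (α s) , λ (x< , eq) → ⇒restrict (proj₁ D.θ[ j ]) (α s) x< eq

      -- A Σ₁ substitute for "a lists the graph of a finite p, and G p has the
      -- value z at y": p is the restriction of θ j to the cube of side α s, and
      -- the occurrence of all points of the cube in a certifies that the cube
      -- is the domain of p.
      Accepts : ℕ → ℕ → ℕ → ℕ → ℕ → Set
      Accepts y z a j s =
        Listᴬ.All (_codesValueOf proj₁ D.θ[ j ]) (decode a) ×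
        (∀ xs → All (_< α s) xs → Any (λ w → π₁ w ≡ tuple {n} xs) (decode a)) ×
        proj₁ E.θ[ g (v ⟨ j , s ⟩) ] (untuple m y) ≡ just z

      C : Pred ℕ 0ℓ
      C w = ∃₂ (Accepts (π₁ (π₁ w)) (π₂ (π₁ w)) (π₂ w))

      C-⟨⟩ : ∀ y z a → C ⟨ ⟨ y , z ⟩ , a ⟩ ≡ ∃₂ (Accepts y z a)
      C-⟨⟩ y z a = cong₂ (λ (y , z) a → ∃₂ (Accepts y z a))
        (trans (cong (proj₁ ∘ unpair) (π₁-⟨⟩ ⟨ y , z ⟩ a)) (unpair-⟨⟩ y z)) (π₂-⟨⟩ ⟨ y , z ⟩ a)

      C-Σ₁ : Σ₁ {1} (λ u → C (lookup u 0F))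
      C-Σ₁ = Σ₁-∃ (Σ₁-∃ (Σ₁-×
        (Σ₁-All S (Σ₁-sub D.value-Σ₁ (var 2F ∷ᶜ ap₁ π₁-computable (var 0F) ∷ᶜ ap₁ π₂-computable (var 0F) ∷ᶜ []ᶜ))
          (ap₁ π₂-computable (var 2F)))
        (Σ₁-×
          (Σ₁-∀cube n
            (Σ₁-Any S (Δ₁⇒Σ₁ (Δ₁-≡ (ap₁ π₁-computable (var 0F)) (var 1F))) (ap₁ π₂-computable (var 3F)))
            (ap₁ α-computable (var 0F)))
          (Σ₁-sub E.value-Σ₁
            (ap₁ (proj₁ (proj₂ G-markov)) (ap₁ (proj₁ (proj₂ (D.uniformIndex RestrictionValue-Σ₁)))
              (ap₂ computable (var 1F) (var 0F))) ∷ᶜ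
             ap₁ π₁-computable (ap₁ π₁-computable (var 2F)) ∷ᶜ
             ap₁ π₂-computable (ap₁ π₁-computable (var 2F)) ∷ᶜ []ᶜ)))))

      C-ce : CE C
      C-ce = Σ₁⇒CE em C-Σ₁

      -- A value of the limit comes from a finite `p ⊑ q`, and a code of the graph of `p` is
      -- accepted. Conversely, an accepted `a` with all entries in the graph of `q` forces `θ j` to
      -- agree with `q` on the whole cube, so that the restriction of `θ j` is a finite part of `q`.
      Ĝ-computable : ComputableOperator P S Ĝ
      Ĝ-computable = C , C-ce , λ (q , _) → graph⇒accepted q , accepted⇒graph q
        where
        Accepted : PFun n → Pred ℕ 0ℓ
        Accepted q w = ∃₂ λ (ys : Vec ℕ m) z → w ≡ ⟨ tuple ys , z ⟩ ×
          ∃ λ a → C ⟨ ⟨ tuple ys , z ⟩ , a ⟩ × Listᴬ.All (graph P q) (decode a)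

        G≗ : ∀ j s (p : Carrier) → proj₁ p ≗ restrict (proj₁ D.θ[ j ]) (α s) →
             G[ p ] ≗ proj₁ E.θ[ g (v ⟨ j , s ⟩) ]
        G≗ j s p p≗ ys = trans (Func.cong G (v-restrict j s p p≗) ys) (proj₂ (proj₂ G-markov) (v ⟨ j , s ⟩) ys)

        accept : ∀ q (p : Carrier) s {ys z} → HasDomain (proj₁ p) (α s) → proj₁ p ⊑ q →
                 G[ p ] ys ≡ just z → Accepted q ⟨ tuple ys , z ⟩
        accept q p s {ys} {z} (_ , p⊆cube , cube⊆p) p⊑q Gp≡z =
          ys , z , refl , a ,
          subst id (sym (C-⟨⟩ (tuple ys) z a))
            -- Here `j` is an index of `p` itself, and `a` codes the list of its graph over the cube
            -- that is its domain.
            (j , s ,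
             Listᴬ.map (λ w∈p → trans (θj≈p _) (graph⇒codesValue w∈p)) a⊆p ,
             (λ xs xs<αs → covers (cubeList-complete xs<αs) (cube⊆p xs<αs)) ,
             trans (cong (proj₁ E.θ[ g (v ⟨ j , s ⟩) ]) (untuple-tuple ys))
                   (trans (sym (G≗ j s p p≗restrict ys)) Gp≡z)) ,
          Listᴬ.map (λ { (xs , z , px≡z , w≡) → xs , z , p⊑q px≡z , w≡ }) a⊆p
          where
          j : ℕ
          j = proj₁ (D.index p)

          θj≈p : D.θ[ j ] ≈ p
          θj≈p = proj₂ (D.index p)

          a : ℕ
          a = proj₁ (graphCode (proj₁ p) (cubeList n (α s)))

          a⊆p : Listᴬ.All (graph P (proj₁ p)) (decode a)
          a⊆p = proj₁ (proj₂ (graphCode (proj₁ p) (cubeList n (α s))))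

          covers : ∀ {xs} → xs ∈ᴸ cubeList n (α s) → xs ∈ dom (proj₁ p) → Any (λ w → π₁ w ≡ tuple xs) (decode a)
          covers = proj₂ (proj₂ (graphCode (proj₁ p) (cubeList n (α s))))

          -- The domain of `p` is the cube already, so restricting to it changes nothing.
          p≗restrict : proj₁ p ≗ restrict (proj₁ D.θ[ j ]) (α s)
          p≗restrict xs = maybe-ext
            (λ px≡z → ⇒restrict (proj₁ D.θ[ j ]) (α s) (p⊆cube (_ , px≡z)) (trans (θj≈p xs) px≡z))
            (λ eq → trans (sym (θj≈p xs)) (proj₂ (restrict⇒ (proj₁ D.θ[ j ]) (α s) eq)))

        graph⇒accepted : ∀ q {w} → graph P (limit q) w → Accepted q w
        graph⇒accepted q (ys , z , eq , refl) =
          let p , b , p-dom , p⊑q , Gp≡z = limit⇒Approx q eq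
              s , b≡αs = A₀⇒α (proj₁ p-dom)
          in accept q p s (subst (HasDomain (proj₁ p)) b≡αs p-dom) p⊑q Gp≡z

        module _ (q : PFun n) {ys z a} j s (accepts : Accepts (tuple ys) z a j s)
                 (a⊆q : Listᴬ.All (graph P q) (decode a)) where
          θj : PFun n
          θj = proj₁ D.θ[ j ]

          -- The point occurs in an entry of `a`, and this entry lies in the graphs of both `θ j`
          -- and `q`; its second component is the common value.
          listed : ∀ {xs} → All (_< α s) xs → ∃ λ z → θj xs ≡ just z × q xs ≡ just z
          listed {xs} xs<αs with w , w∈a , π₁w≡ ← find (proj₁ (proj₂ accepts) xs xs<αs) =
            π₂ w , trans (cong θj (sym w-arg)) (Listᴬ.lookup (proj₁ accepts) w∈a) ,
                   trans (cong q (sym w-arg)) (graph⇒codesValue (Listᴬ.lookup a⊆q w∈a))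
            where
            w-arg : untuple n (π₁ w) ≡ xs
            w-arg = trans (cong (untuple n) π₁w≡) (untuple-tuple xs)

          p-dom : HasDomain (restrict θj (α s)) (α s)
          p-dom = restrict-hasDomain θj (A₀-α s) λ xs<αs → let z , θjx≡z , _ = listed xs<αs in z , θjx≡z

          p : Carrier
          p = restrict θj (α s) , inj₂ (hasDomain⇒anf p-dom)

          p⊑q : proj₁ p ⊑ q
          p⊑q eq =
            let xs<αs , θjx≡z = restrict⇒ θj (α s) eq
                _ , θjx≡z′ , qx≡z′ = listed xs<αs
            in trans qx≡z′ (trans (sym θjx≡z′) θjx≡z)

          Gp≡z : G[ p ] ys ≡ just z
          Gp≡z = trans (G≗ j s p (λ _ → refl) ys)
            (trans (cong (proj₁ E.θ[ g (v ⟨ j , s ⟩) ]) (sym (untuple-tuple ys))) (proj₂ (proj₂ accepts)))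

          accepts⇒Approx : Approx q ys z
          accepts⇒Approx = p , α s , p-dom , p⊑q , Gp≡z

        accepted⇒graph : ∀ q {w} → Accepted q w → graph P (limit q) w
        accepted⇒graph q (ys , z , refl , a , c , a⊆q) =
          let j , s , accepts = subst id (C-⟨⟩ (tuple ys) z a) c
          in ys , z , Approx⇒limit q (accepts⇒Approx q j s accepts a⊆q) , refl

theorem7p7 : ExcludedMiddle 0ℓ →
    (P : Pairing) (S : SequenceCoding) →
    (A : Pred ℕ 0ℓ) → Infinite A → CE A →
    (m n : ℕ) .{{_ : NonZero m}} .{{_ : NonZero n}} →
    (θ : (i : ℕ) .{{_ : NonZero i}} → Numbering (𝒮 A i)) →
    ((i : ℕ) .{{_ : NonZero i}} → IsQuasiGödel P (θ i)) →
    ((Ĝ : Ŝ A n ⟶ₛ Ŝ A m) → ComputableOperator P S Ĝ →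
    ∃ λ (G : 𝒮 A n ⟶ₛ 𝒮 A m) →
    G IsRestrictionOf Ĝ × MarkovComputable (θ n) (θ m) G)
    ×
    ((G : 𝒮 A n ⟶ₛ 𝒮 A m) → MarkovComputable (θ n) (θ m) G →
    ∃ λ (Ĝ : Ŝ A n ⟶ₛ Ŝ A m) →
    ComputableOperator P S Ĝ × G IsRestrictionOf Ĝ)
theorem7p7 em P S A A-infinite A-ce m n θ θ-quasiGödel =
  computable⇒markovComputable S (θ n) (θ-quasiGödel n) (θ m) (θ-quasiGödel m) ,
  λ G G-markov →
    -- Whatever `n` and `m` are, the unary numbering `θ 1` serves to define `K`.
    let open Extension S (θ n) (θ-quasiGödel n) (θ m) (θ-quasiGödel m)
                       em A-infinite A-ce (θ 1) (θ-quasiGödel 1) G G-markov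
    in Ĝ , Ĝ-computable , G-restricts-Ĝ
  where open Semidecidability P
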